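{- There is an algorithm on a random access machine which, given $n\in\mathbb{N}$ with $n\ge1$ and $X\in\mathrm{IS}$ with $\mathrm{len}(X)=L(n)$, decides whether $X$ computes $\mathrm{tstnz}_n$ in time $O(n^2)$.
   Context: Basic instructions: $\mathtt{in}{:}i.\mathtt{get}$ ($i\ge1$), $\mathtt{out}.\mathtt{set}{:}b$ ($b\in\{0,1\}$), $\mathtt{aux}{:}i.\mathtt{get}$ ($i\ge1$), $\mathtt{aux}{:}i.\mathtt{set}{:}b$ ($i\ge1$, $b\in\{0,1\}$). The part before the dot names a Boolean register ($\mathtt{in}{:}i$ input, $\mathtt{out}$ output, $\mathtt{aux}{:}i$ auxiliary); $\mathtt{get}$ changes nothing and replies the content, $\mathtt{set}{:}b$ makes the content $b$ and replies $b$. Primitive instructions: for each basic instruction $a$, plain $a$, positive test $+a$, negative test $-a$; forward jumps $\#l$ ($l\in\mathbb{N}$); termination $!$. $\mathrm{IS}$ is the set of finite sequences $X=u_1;\dots;u_k$ of primitive instructions, $\mathrm{len}(X)=k$. Execution starts at $u_1$: plain $a$ executes $a$ and proceeds with the next instruction; $+a$ executes $a$ and proceeds with the next instruction if the reply is $1$, otherwise skips the next one and proceeds with the one after it; $-a$ likewise with replies reversed; $\#l$ proceeds with the $l$-th next instruction; $!$ terminates. If $l=0$ or there is no instruction to proceed with, execution never terminates. For $f:\{0,1\}^n\to\{0,1\}$, $X$ computes $f$ if there is $k$ such that for all $b_1,\dots,b_n$, executing $X$ with $\mathtt{in}{:}i$ initially $b_i$, $\mathtt{out}$ and $\mathtt{aux}{:}1,\dots,\mathtt{aux}{:}k$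 initially $0$ (other registers arbitrary) terminates with final content of $\mathtt{out}$ equal to $f(b_1,\dots,b_n)$. $\mathrm{tstnz}_n(b_1,\dots,b_n)=1$ iff some $b_i=1$. $L(n)=3n/2+1$ for even $n$, $3(n+1)/2$ for odd $n$. Model: random access machine in the sense of Cook and Reckhow (without multiplication/division), uniform cost criterion; each primitive instruction of the input is represented by two integers (its form and its natural-number parameter, or $-1$ if none). -}

module Defs where

open import Data.Nat using (ℕ; zero; suc; _+_; _*_; _≤_; _≡ᵇ_)
open import Data.Nat.DivMod using (_/_; _%_)
open import Data.Integer as ℤ using (ℤ; +_; -[1+_]; _<?_)
open import Data.Bool using (Bool; true; false; if_then_else_; not; _∨_)
open import Data.List using (List; []; _∷_; drop; length; _++_; concatMap)
open import Data.List.Relation.Unary.All using (All)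
open import Data.Vec using (Vec; lookup) renaming ([] to []ᵥ; _∷_ to _∷ᵥ_)
open import Data.Fin using (Fin; toℕ)
open import Data.Maybe using (Maybe; just; nothing)
open import Data.Product using (_×_; _,_; proj₁; proj₂; Σ; ∃)
open import Data.Unit using (⊤)
open import Relation.Nullary using (does)
open import Relation.Binary.PropositionalEquality using (_≡_)

-- Single-pass instruction sequences (register indices are naturals;
-- the index 0 is not allowed in IS, see ValidBasic).

data Basic : Set where
  inGet  : ℕ → Basic
  outSet : Bool → Basic
  auxGet : ℕ → Basic
  auxSet : ℕ → Bool → Basic

data Prim : Set where
  plain : Basic → Prim
  ptest : Basic → Prim
  ntest : Basic → Prim
  jump  : ℕ → Prim
  halt  : Prim

ValidBasic : Basic → Set
ValidBasic (inGet i)    = 1 ≤ i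
ValidBasic (outSet b)   = ⊤
ValidBasic (auxGet i)   = 1 ≤ i
ValidBasic (auxSet i b) = 1 ≤ i

ValidPrim : Prim → Set
ValidPrim (plain a) = ValidBasic a
ValidPrim (ptest a) = ValidBasic a
ValidPrim (ntest a) = ValidBasic a
ValidPrim (jump l)  = ⊤
ValidPrim halt      = ⊤

IS : List Prim → Set
IS X = All ValidPrim X

record State : Set where
  constructor mkState
  field
    inR  : ℕ → Bool
    outR : Bool
    auxR : ℕ → Bool
open State public

updB : (ℕ → Bool) → ℕ → Bool → (ℕ → Bool)
updB f i b j = if j ≡ᵇ i then b else f j

doBasic : Basic → State → State × Bool
doBasic (inGet i)    s = s , inR s i
doBasic (outSet b)   s = mkState (inR s) b (auxR s) , b
doBasic (auxGet i)   s = s , auxR s i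
doBasic (auxSet i b) s = mkState (inR s) (outR s) (updB (auxR s) i b) , b

-- execution with fuel; nothing = no termination.  Every step strictly
-- shortens the remaining sequence, so fuel suc (length X) never runs out.
execF : ℕ → List Prim → State → Maybe State
execF zero    _                _ = nothing
execF (suc f) []               s = nothing
execF (suc f) (plain a ∷ rest) s = execF f rest (proj₁ (doBasic a s))
execF (suc f) (ptest a ∷ rest) s with doBasic a s
... | s' , true  = execF f rest s'
... | s' , false = execF f (drop 1 rest) s'
execF (suc f) (ntest a ∷ rest) s with doBasic a s
... | s' , false = execF f rest s'
... | s' , true  = execF f (drop 1 rest) s'
execF (suc f) (jump zero ∷ rest)    s = nothing
execF (suc f) (jump (suc l) ∷ rest) s = execF f (drop l rest) s
execF (suc f) (halt ∷ rest)      s = just s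

exec : List Prim → State → Maybe State
exec X s = execF (suc (length X)) X s

Computes : List Prim → {n : ℕ} → (Vec Bool n → Bool) → Set
Computes X {n} f =
  ∃ λ (k : ℕ) → (b : Vec Bool n) (inp : ℕ → Bool) (aux : ℕ → Bool) →
    ((i : Fin n) → inp (suc (toℕ i)) ≡ lookup b i) →
    ((i : ℕ) → 1 ≤ i → i ≤ k → aux i ≡ false) →
    Σ State λ s → (exec X (mkState inp false aux) ≡ just s) × (outR s ≡ f b)

tstnz : {n : ℕ} → Vec Bool n → Bool
tstnz []ᵥ       = false
tstnz (x ∷ᵥ xs) = x ∨ tstnz xs

L : ℕ → ℕ
L n = if n % 2 ≡ᵇ 0 then 3 * n / 2 + 1 else 3 * (n + 1) / 2

-- Random access machine (Cook–Reckhow, no multiplication/division),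
-- uniform cost: each executed instruction costs one time unit.

data RInstr : Set where
  LOAD   : ℤ → ℕ → RInstr
  ADD    : ℕ → ℕ → ℕ → RInstr
  SUB    : ℕ → ℕ → ℕ → RInstr
  ILOAD  : ℕ → ℕ → RInstr
  ISTORE : ℕ → ℕ → RInstr
  JPOS   : ℕ → ℕ → RInstr
  READ   : ℕ → RInstr
  PRINT  : ℕ → RInstr
  HALT   : RInstr

RProgram : Set
RProgram = List RInstr

record Config : Set where
  constructor mkConfig
  field
    pc     : ℕ
    regs   : ℕ → ℤ
    input  : List ℤ
    output : List ℤ
open Config public

data StepResult : Set where
  halted : List ℤ → StepResult
  next   : Config → StepResult
  stuck  : StepResult

updZ : (ℕ → ℤ) → ℕ → ℤ → (ℕ → ℤ)
updZ f i x j = if j ≡ᵇ i then x else f j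

fetch : RProgram → ℕ → Maybe RInstr
fetch []      _       = nothing
fetch (x ∷ _) zero    = just x
fetch (_ ∷ p) (suc k) = fetch p k

exeR : RInstr → Config → StepResult
exeR (LOAD c i) (mkConfig pc r inp out) = next (mkConfig (suc pc) (updZ r i c) inp out)
exeR (ADD i j k) (mkConfig pc r inp out) =
  next (mkConfig (suc pc) (updZ r i (r j ℤ.+ r k)) inp out)
exeR (SUB i j k) (mkConfig pc r inp out) =
  next (mkConfig (suc pc) (updZ r i (r j ℤ.- r k)) inp out)
exeR (ILOAD i j) (mkConfig pc r inp out) with r j
... | + a    = next (mkConfig (suc pc) (updZ r i (r a)) inp out)
... | -[1+ _ ] = stuck
exeR (ISTORE i j) (mkConfig pc r inp out) with r i
... | + a    = next (mkConfig (suc pc) (updZ r a (r j)) inp out)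
... | -[1+ _ ] = stuck
exeR (JPOS m j) (mkConfig pc r inp out) =
  if does (+ 0 <? r j) then next (mkConfig m r inp out)
                      else next (mkConfig (suc pc) r inp out)
exeR (READ i) (mkConfig pc r [] out) = stuck
exeR (READ i) (mkConfig pc r (x ∷ inp) out) = next (mkConfig (suc pc) (updZ r i x) inp out)
exeR (PRINT i) (mkConfig pc r inp out) = next (mkConfig (suc pc) r inp (out ++ (r i ∷ [])))
exeR HALT c = halted (output c)

stepR : RProgram → Config → StepResult
stepR P c with fetch P (pc c)
... | nothing = halted (output c)
... | just ι  = exeR ι c

runR : RProgram → ℕ → Config → Maybe (List ℤ)
runR P zero    c = nothing
runR P (suc t) c with stepR P c
... | halted o = just o
... | next c'  = runR P t c'
... | stuck    = nothing

initConfig : List ℤ → Config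
initConfig inp = mkConfig 0 (λ _ → + 0) inp []

-- Input encoding: each primitive instruction as two integers
-- (form, parameter or -1).

basicForm : Basic → ℕ
basicForm (inGet _)        = 0
basicForm (outSet false)   = 1
basicForm (outSet true)    = 2
basicForm (auxGet _)       = 3
basicForm (auxSet _ false) = 4
basicForm (auxSet _ true)  = 5

basicParam : Basic → ℤ
basicParam (inGet i)    = + i
basicParam (outSet _)   = -[1+ 0 ]
basicParam (auxGet i)   = + i
basicParam (auxSet i _) = + i

encodePrim : Prim → List ℤ
encodePrim (plain a) = + basicForm a ∷ basicParam a ∷ []
encodePrim (ptest a) = + (6 + basicForm a) ∷ basicParam a ∷ []
encodePrim (ntest a) = + (12 + basicForm a) ∷ basicParam a ∷ []
encodePrim (jump l)  = + 18 ∷ + l ∷ []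
encodePrim halt      = + 19 ∷ -[1+ 0 ] ∷ []

ramInput : ℕ → List Prim → List ℤ
ramInput n X = + n ∷ concatMap encodePrim X

answer : Bool → List ℤ
answer true  = + 1 ∷ []
answer false = + 0 ∷ []

{-# OPTIONS --safe #-}
module Submission where

-- On the all-zero input every variable has to be tested, and with only L(n)
-- instructions this forces the path of that input to be tiled by blocks
-- −in:i ; +in:j ; z, one block +in:i ; z exactly when n is odd, and a final !.
-- The path is left only through the slots z.  A slot reached with out = 0 has to
-- set out to 1, to jump to a later slot or, directly before the single block, to
-- skip to the slot of that block.  These conditions are local, except that a skip
-- by +in:k also depends on the earliest block from which its slot can be reached.
-- Propagating this information along the jumps, a single pass over X decides
-- correctness, even in linear time.

open import Defs
open import Data.Nat
open import Data.Nat.DivMod using (m%n<n; +-distrib-/)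
open import Data.Nat.Properties
open import Data.Nat.Tactic.RingSolver using (solve-∀)
open import Data.Integer as ℤ using (ℤ; +_; -[1+_])
import Data.Integer.Properties as ℤₚ
open import Data.Bool using (Bool; true; false; if_then_else_; _∨_)
open import Data.Bool.Properties using (T-≡; ∨-zeroʳ)
open import Data.Empty using (⊥; ⊥-elim)
open import Data.Fin using (Fin; toℕ; fromℕ<) renaming (zero to fzero; suc to fsuc)
open import Data.Fin.Properties using (toℕ<n; toℕ-fromℕ<)
open import Data.List using (List; []; _∷_; length; drop; _++_; concatMap)
open import Data.List.Properties using (length-drop; length-++)
open import Data.List.Relation.Unary.All using (All; []; _∷_)
open import Data.Maybe as Maybe using (Maybe; just; nothing; maybe′)
open import Data.Maybe.Properties using (just-injective)
open import Data.Product using (Σ; ∃; _×_; _,_; proj₁; proj₂)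
open import Data.Sum using (_⊎_; inj₁; inj₂; map₂)
open import Data.Vec using (Vec; lookup; tabulate; replicate) renaming ([] to []ᵥ; _∷_ to _∷ᵥ_)
open import Data.Vec.Properties using (lookup∘tabulate)
open import Function using (_∘_)
open import Function.Bundles using (_⇔_; mk⇔; Equivalence)
open import Function.Construct.Composition using (_⇔-∘_)
open import Relation.Binary.PropositionalEquality
open import Relation.Nullary
open import Relation.Nullary.Decidable using (map′)

-- Why tightness forces the blocks: until the path of the zero input tests `in:v`, the input whose
-- only 1 is at `v` is in the same state as the zero input, so the rest of the sequence must still
-- separate the two. A potential measures this: twice the remaining length is at least three times
-- the number of unread variables plus 2, the 2 paying for the final `!`. For the whole sequence
-- `L(n)` attains this bound for even `n` and exceeds it by 1 for odd `n`; that single unit is what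
-- one block `+in:i ; z` wastes, and any other waste is too large.
--
-- The obstacle behind the slots: one slot may be entered from several blocks with different
-- knowledge. A run leaving the path at some block knows only that the variables tested before that
-- block are 0. The weakest knowledge is that of the earliest block, so one number per position, the
-- maximum of the remaining lengths, summarises all entries. For necessity, each such number comes
-- with a concrete input that attains it.

-- Execution as a structural recursion

-- The second argument is the number of instructions still to be skipped.
run : List Prim → ℕ → State → Maybe Bool
run []                   _       s = nothing
run (_ ∷ Y)              (suc k) s = run Y k s
run (plain a ∷ Y)        zero    s = run Y 0 (proj₁ (doBasic a s))
run (ptest a ∷ Y)        zero    s =
  if proj₂ (doBasic a s) then run Y 0 (proj₁ (doBasic a s)) else run Y 1 (proj₁ (doBasic a s))
run (ntest a ∷ Y)        zero    s =
  if proj₂ (doBasic a s) then run Y 1 (proj₁ (doBasic a s)) else run Y 0 (proj₁ (doBasic a s))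
run (jump zero ∷ Y)      zero    s = nothing
run (jump (suc l) ∷ Y)   zero    s = run Y l s
run (halt ∷ Y)           zero    s = just (outR s)

run-drop : ∀ k Y s → run Y k s ≡ run (drop k Y) 0 s
run-drop zero    Y       s = refl
run-drop (suc k) []      s = refl
run-drop (suc k) (x ∷ Y) s = run-drop k Y s

length-drop-≤ : ∀ k (Y : List Prim) → length (drop k Y) ≤ length Y
length-drop-≤ k Y rewrite length-drop k Y = m∸n≤m (length Y) k

execF-run : ∀ f Y s → length Y < f → Maybe.map outR (execF f Y s) ≡ run Y 0 s
execF-run-drop : ∀ f k Y s → length Y < f → Maybe.map outR (execF f (drop k Y) s) ≡ run Y k s

execF-run-drop f k Y s lt =
  trans (execF-run f (drop k Y) s (≤-<-trans (length-drop-≤ k Y) lt)) (sym (run-drop k Y s))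

execF-run (suc f) []                   s lt = refl
execF-run (suc f) (plain a ∷ Y)        s lt = execF-run f Y _ (s≤s⁻¹ lt)
execF-run (suc f) (ptest a ∷ Y)        s lt with doBasic a s
... | s' , true  = execF-run f Y s' (s≤s⁻¹ lt)
... | s' , false = execF-run-drop f 1 Y s' (s≤s⁻¹ lt)
execF-run (suc f) (ntest a ∷ Y)        s lt with doBasic a s
... | s' , true  = execF-run-drop f 1 Y s' (s≤s⁻¹ lt)
... | s' , false = execF-run f Y s' (s≤s⁻¹ lt)
execF-run (suc f) (jump zero ∷ Y)      s lt = refl
execF-run (suc f) (jump (suc l) ∷ Y)   s lt = execF-run-drop f l Y s (s≤s⁻¹ lt)
execF-run (suc f) (halt ∷ Y)           s lt = refl

exec-run : ∀ Y s → Maybe.map outR (exec Y s) ≡ run Y 0 s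
exec-run Y s = execF-run (suc (length Y)) Y s ≤-refl

run⇒exec : ∀ Y s {b} → run Y 0 s ≡ just b → Σ State λ s' → exec Y s ≡ just s' × outR s' ≡ b
run⇒exec Y s eq with exec Y s | exec-run Y s
... | just s' | p = s' , refl , just-injective (trans p eq)
... | nothing | p with () ← trans p eq

exec⇒run : ∀ Y s {s'} → exec Y s ≡ just s' → run Y 0 s ≡ just (outR s')
exec⇒run Y s eq = trans (sym (exec-run Y s)) (cong (Maybe.map outR) eq)

run-short : ∀ Y k s {b} → run Y k s ≡ just b → k < length Y
run-short (x ∷ Y) (suc k) s eq = s<s (run-short Y k s eq)
run-short (x ∷ Y) zero    s eq = z<s

-- Changing `out` takes one instruction and terminating takes another. This sharpens the count for
-- `-in:i ; !` followed by `Y` when `n` is odd.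
run-set : ∀ Y s → outR s ≡ false → run Y 0 s ≡ just true → 2 ≤ length Y
run-set (x ∷ y ∷ Y) s o eq = s≤s (s≤s z≤n)
run-set (ptest a ∷ []) s o eq with proj₂ (doBasic a s) | eq
... | true | ()
... | false | ()
run-set (ntest a ∷ []) s o eq with proj₂ (doBasic a s) | eq
... | true | ()
... | false | ()
run-set (jump (suc l) ∷ []) s o ()
run-set (halt ∷ []) s o eq rewrite o with eq
... | ()

if-true : ∀ {A : Set} {c} {x y : A} → c ≡ true → (if c then x else y) ≡ x
if-true refl = refl

if-false : ∀ {A : Set} {c} {x y : A} → c ≡ false → (if c then x else y) ≡ y
if-false refl = refl

≡ᵇ-refl : ∀ i → (i ≡ᵇ i) ≡ true
≡ᵇ-refl zero    = refl
≡ᵇ-refl (suc i) = ≡ᵇ-refl i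

≢⇒≡ᵇ : ∀ {i j} → i ≢ j → (i ≡ᵇ j) ≡ false
≢⇒≡ᵇ {i} {j} ne with i ≡ᵇ j in eq
... | false = refl
... | true  = ⊥-elim (ne (≡ᵇ⇒≡ i j (Equivalence.from T-≡ eq)))

upd : ∀ {A : Set} → (ℕ → A) → ℕ → A → ℕ → A
upd f i x j = if j ≡ᵇ i then x else f j

upd-same : ∀ {A : Set} (f : ℕ → A) i x → upd f i x i ≡ x
upd-same f i x rewrite ≡ᵇ-refl i = refl

upd-other : ∀ {A : Set} (f : ℕ → A) {i j} x → j ≢ i → upd f i x j ≡ f j
upd-other f x ne rewrite ≢⇒≡ᵇ ne = refl

-- Counting unread variables

record Fresh (n : ℕ) (pos : ℕ → ℕ) (v : ℕ) : Set where
  constructor fresh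
  field
    low    : 1 ≤ v
    high   : v ≤ n
    unread : pos v ≡ 0

isZero : ℕ → ℕ
isZero zero    = 1
isZero (suc _) = 0

count : ℕ → (ℕ → ℕ) → ℕ
count zero    pos = 0
count (suc n) pos = isZero (pos (suc n)) + count n pos

upd-nonzero : ∀ pos i {r} v → 0 < r → upd pos i r v ≡ 0 → v ≢ i × pos v ≡ 0
upd-nonzero pos i {r} v r>0 eq with v ≟ i
... | yes refl = ⊥-elim (<⇒≢ r>0 (sym (trans (sym (upd-same pos i r)) eq)))
... | no ne    = ne , trans (sym (upd-other pos r ne)) eq

Fresh-upd : ∀ {n pos i r v} → 0 < r → Fresh n (upd pos i r) v → v ≢ i × Fresh n pos v
Fresh-upd {pos = pos} {i} {r} {v} r>0 (fresh a b c) with upd-nonzero pos i v r>0 c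
... | ne , z = ne , fresh a b z

Fresh-suc : ∀ {n pos v} → Fresh n pos v → Fresh (suc n) pos v
Fresh-suc (fresh a b c) = fresh a (m≤n⇒m≤1+n b) c

count-out : ∀ n pos i r → n < i → count n (upd pos i r) ≡ count n pos
count-out zero    pos i r lt = refl
count-out (suc n) pos i r lt
  rewrite ≢⇒≡ᵇ (<⇒≢ lt) = cong (λ c → isZero (pos (suc n)) + c) (count-out n pos i r (<-trans ≤-refl lt))

count-fresh : ∀ n pos i {r} → 0 < r → Fresh n pos i → count n pos ≡ suc (count n (upd pos i r))
count-fresh zero    pos i r>0 (fresh a b c) with () ← ≤-trans a b
count-fresh (suc n) pos i {suc r} r>0 (fresh a b c) with suc n ≟ i
... | yes refl rewrite c | ≡ᵇ-refl n = cong suc (sym (count-out n pos (suc n) (suc r) ≤-refl))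
... | no ne rewrite ≢⇒≡ᵇ ne
      | count-fresh n pos i {suc r} r>0 (fresh a (s≤s⁻¹ (≤∧≢⇒< b (ne ∘ sym))) c) = +-suc _ _

count-stale : ∀ n pos i {r} → 0 < r → ¬ Fresh n pos i → count n (upd pos i r) ≡ count n pos
count-stale zero    pos i r>0 nf = refl
count-stale (suc n) pos i {suc r} r>0 nf with suc n ≟ i
... | no ne rewrite ≢⇒≡ᵇ ne = cong (λ c → isZero (pos (suc n)) + c) (count-stale n pos i r>0 (nf ∘ Fresh-suc))
... | yes refl rewrite ≡ᵇ-refl n with pos (suc n) in eq
...   | zero  = ⊥-elim (nf (fresh (s≤s z≤n) ≤-refl eq))
...   | suc _ = count-out n pos (suc n) (suc r) ≤-refl

fresh? : ∀ n pos i → Dec (Fresh n pos i)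
fresh? n pos i = map′ (λ (a , b , c) → fresh a b c) (λ (fresh a b c) → a , b , c)
  ((1 ≤? i) ×-dec ((i ≤? n) ×-dec (pos i ≟ 0)))

count-upd : ∀ n pos i {r} → 0 < r → count n pos ≤ suc (count n (upd pos i r))
count-upd n pos i r>0 with fresh? n pos i
... | yes f = ≤-reflexive (count-fresh n pos i r>0 f)
... | no nf = m≤n⇒m≤1+n (≤-reflexive (sym (count-stale n pos i r>0 nf)))

count-find : ∀ n pos → count n pos ≡ 0 ⊎ ∃ (Fresh n pos)
count-find zero    pos = inj₁ refl
count-find (suc n) pos with pos (suc n) in eq
... | zero  = inj₂ (suc n , fresh (s≤s z≤n) ≤-refl eq)
... | suc _ with count-find n pos
...   | inj₁ z       = inj₁ z
...   | inj₂ (v , f) = inj₂ (v , Fresh-suc f)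

count-zero : ∀ n pos → count n pos ≡ 0 → ∀ v → ¬ Fresh n pos v
count-zero n pos z v f with () ← trans (sym z) (count-fresh n pos v {1} z<s f)

count-init : ∀ n → count n (λ _ → 0) ≡ n
count-init zero    = refl
count-init (suc n) = cong suc (count-init n)

-- The local criterion

-- Positions are counted from the end of X.  pos k is the number of instructions
-- remaining at the block in which the all-zero run tests in:k, and 0 before that;
-- dem a is the largest such number among the blocks from which the position with a
-- instructions remaining can be reached with out = 0, and 0 if there is none.
demand : (ℕ → ℕ) → ℕ → ℕ → ℕ → ℕ
demand dem a m = upd dem a (dem a ⊔ m)

-- With out = 0 and all auxiliary registers 0, these tests always skip.  Only the slot
-- directly before the single block can use this: elsewhere the target is no slot.
data Skip : Prim → Set where
  +out0 : Skip (ptest (outSet false))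
  +aux0 : ∀ {k} → Skip (ptest (auxSet k false))
  -aux1 : ∀ {k} → Skip (ntest (auxSet k true))
  +aux  : ∀ {k} → Skip (ptest (auxGet k))

-- Here `m` is the earliest block from which the slot is reached with `out` = 0. In `-set` the reply
-- 1 skips an instruction, so two must remain. In `skipIn` the reply 1 falls back onto the path:
-- with `k` unread, a later test finds the 1; with `m < pos k`, the variable was tested before every
-- such block and is 0.
data SlotOk (n : ℕ) (pos dem : ℕ → ℕ) (m r : ℕ) : Prim → (ℕ → ℕ) → Set where
  set    : SlotOk n pos dem m r (plain (outSet true)) dem
  +set   : SlotOk n pos dem m r (ptest (outSet true)) dem
  -set   : 2 ≤ r → SlotOk n pos dem m r (ntest (outSet true)) dem
  link   : ∀ {l} → l < r → SlotOk n pos dem m r (jump (suc l)) (demand dem (r ∸ l) m)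
  skip   : ∀ {z} → Skip z → 2 ≤ r → SlotOk n pos dem m r z (demand dem (r ∸ 1) m)
  skipIn : ∀ {k} → 2 ≤ r → (pos k ≡ 0 × k ≤ n) ⊎ m < pos k →
           SlotOk n pos dem m r (ptest (inGet k)) (demand dem (r ∸ 1) m)

-- No demand may fall on the beginning of a block, on `+in:j` or on `!`: an input with 1s only at
-- variables already tested would follow the path from there and end with `out` = 0. At a slot the
-- own block contributes `r` to the demand. `odd` says that the single block is still ahead.
data Acc (n : ℕ) : Bool → (pos dem : ℕ → ℕ) → List Prim → Set where
  stop   : ∀ {odd pos dem} → dem 1 ≡ 0 → Acc n odd pos dem (halt ∷ [])
  pair   : ∀ {odd pos dem dem' i j z Y} → let r = 3 + length Y
                                              pos₁ = upd pos i r
                                              pos₂ = upd pos₁ j r in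
           i ≤ n → pos i ≡ 0 → dem r ≡ 0 → j ≤ n → pos₁ j ≡ 0 → dem (2 + length Y) ≡ 0 →
           SlotOk n pos₂ dem (dem (1 + length Y) ⊔ r) (length Y) z dem' →
           Acc n odd pos₂ dem' Y →
           Acc n odd pos dem (ntest (inGet i) ∷ ptest (inGet j) ∷ z ∷ Y)
  single : ∀ {pos dem dem' i z Y} → let r = 2 + length Y
                                        pos₁ = upd pos i r in
           i ≤ n → pos i ≡ 0 → dem r ≡ 0 →
           SlotOk n pos₁ dem (dem (1 + length Y) ⊔ r) (length Y) z dem' →
           Acc n false pos₁ dem' Y →
           Acc n true pos dem (ptest (inGet i) ∷ z ∷ Y)

bit : Bool → ℕ
bit true = 1
bit false = 0

-- Lengths are doubled to avoid halves. A single block spends 4 on a variable worth 3, which uses up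
-- the odd unit; a pair spends 6 on two variables and leaves the unit untouched.
single-eq : ∀ n pos i y → Fresh n pos i → 2 * (2 + y) ≡ 3 * count n pos + 2 + 1 →
            2 * y ≡ 3 * count n (upd pos i (2 + y)) + 2 + 0
single-eq n pos i y f eq = +-cancelˡ-≡ 4 _ _
  (trans (lem₁ y) (trans eq (trans (cong (λ c → 3 * c + 2 + 1) (count-fresh n pos i z<s f)) (lem₂ _))))
  where
  lem₁ : ∀ y → 4 + 2 * y ≡ 2 * (2 + y)
  lem₁ = solve-∀
  lem₂ : ∀ c → 3 * (1 + c) + 2 + 1 ≡ 4 + (3 * c + 2 + 0)
  lem₂ = solve-∀

pair-eq : ∀ n pos i j y o → let r = 3 + y in Fresh n pos i → Fresh n (upd pos i r) j →
          2 * (3 + y) ≡ 3 * count n pos + 2 + o → 2 * y ≡ 3 * count n (upd (upd pos i r) j r) + 2 + o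
pair-eq n pos i j y o f g eq = +-cancelˡ-≡ 6 _ _
  (trans (lem₁ y) (trans eq (trans (cong (λ c → 3 * c + 2 + o)
    (trans (count-fresh n pos i z<s f) (cong suc (count-fresh n _ j z<s g)))) (lem₂ _ o))))
  where
  lem₁ : ∀ y → 6 + 2 * y ≡ 2 * (3 + y)
  lem₁ = solve-∀
  lem₂ : ∀ c o → 3 * (2 + c) + 2 + o ≡ 6 + (3 * c + 2 + o)
  lem₂ = solve-∀

-- Sufficiency of the conditions on the slots

-- The knowledge of a run that leaves the path at block `m`: positions decrease along the path, so
-- `m < pos k` means tested earlier.
Low : ℕ → (ℕ → ℕ) → (ℕ → Bool) → Set
Low m pos b = ∀ k → m < pos k → b k ≡ false

Low-upd : ∀ {m} pos {i r b} → r ≤ m → Low m pos b → Low m (upd pos i r) b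
Low-upd {m} pos {i} {r} r≤m low k lt with k ≟ i
... | yes refl = ⊥-elim (<⇒≱ (subst (m <_) (upd-same pos i r) lt) r≤m)
... | no ne    = low k (subst (m <_) (upd-other pos r ne) lt)

Low-read : ∀ {m} pos {i r b} → b i ≡ false → Low m pos b → Low m (upd pos i r) b
Low-read {m} pos {i} {r} z low k lt with k ≟ i
... | yes refl = z
... | no ne    = low k (subst (m <_) (upd-other pos r ne) lt)

demand-hit : ∀ dem a m → demand dem a m a ≡ dem a ⊔ m
demand-hit dem a m = upd-same dem a (dem a ⊔ m)

demand-≥ : ∀ dem a m b → dem b ≤ demand dem a m b
demand-≥ dem a m b with b ≟ a
... | yes refl = subst (dem a ≤_) (sym (demand-hit dem a m)) (m≤m⊔n (dem a) m)
... | no ne    = ≤-reflexive (sym (upd-other dem _ ne))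

demand-hit-≥ : ∀ dem a m → m ≤ demand dem a m a
demand-hit-≥ dem a m = subst (m ≤_) (sym (demand-hit dem a m)) (m≤n⊔m (dem a) m)

slot-≥ : ∀ {n pos dem m r z dem'} → SlotOk n pos dem m r z dem' → ∀ a → dem a ≤ dem' a
slot-≥ set          a = ≤-refl
slot-≥ +set         a = ≤-refl
slot-≥ (-set _)     a = ≤-refl
slot-≥ {dem = dem} {m} (link _)     a = demand-≥ dem _ m a
slot-≥ {dem = dem} {m} (skip _ _)   a = demand-≥ dem _ m a
slot-≥ {dem = dem} {m} (skipIn _ _) a = demand-≥ dem _ m a

-- Demands stem from blocks already passed, where more instructions remained. Hence variables tested
-- from now on get positions that no existing demand speaks of.
Floor : ℕ → (ℕ → ℕ) → Set
Floor r dem = ∀ a → 0 < dem a → r ≤ dem a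

demand-floor : ∀ {r dem m} a → r ≤ m → Floor r dem → Floor r (demand dem a m)
demand-floor {r} {dem} {m} a r≤m fl b lt with b ≟ a
... | yes refl = ≤-trans r≤m (demand-hit-≥ dem b m)
... | no ne    = subst (r ≤_) (sym (upd-other dem _ ne)) (fl b (subst (0 <_) (upd-other dem _ ne) lt))

slot-floor : ∀ {n pos dem m r z dem' q} → q ≤ m → Floor q dem → SlotOk n pos dem m r z dem' → Floor q dem'
slot-floor q≤m fl set          = fl
slot-floor q≤m fl +set         = fl
slot-floor q≤m fl (-set _)     = fl
slot-floor q≤m fl (link _)     = demand-floor _ q≤m fl
slot-floor q≤m fl (skip _ _)   = demand-floor _ q≤m fl
slot-floor q≤m fl (skipIn _ _) = demand-floor _ q≤m fl

-- Among admissible slots only `+aux:k.get` depends on the initial content of an auxiliary register,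
-- so only these indices have to be covered by the bound `K`.
auxIndex : Prim → ℕ
auxIndex (ptest (auxGet k)) = k
auxIndex _                  = 0

tight-end : ∀ c o → 2 ≡ 3 * c + 2 + o → c ≡ 0
tight-end zero    o eq = refl
tight-end (suc c) o eq = ⊥-elim (<⇒≢ lt eq)
  where
  lem : ∀ c → 3 * c + 2 + 3 ≡ 3 * suc c + 2
  lem = solve-∀
  lt : 2 < 3 * suc c + 2 + o
  lt = ≤-trans (m≤n+m 3 (3 * c + 2)) (≤-trans (≤-reflexive (lem c)) (m≤m+n _ _))

module _ (n K : ℕ) where

  AuxOk : State → Set
  AuxOk s = ∀ k → 1 ≤ k → k ≤ K → auxR s k ≡ false

  -- After the single block (odd = false) a demanded slot succeeds from every state.
  Pre : Bool → (ℕ → ℕ) → ℕ → State → Set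
  Pre odd pos m s = outR s ≡ true ⊎ odd ≡ false ⊎ (AuxOk s × Low m pos (inR s))

  Pre-mono : ∀ {odd pos m m' s} → m ≤ m' → Pre odd pos m s → Pre odd pos m' s
  Pre-mono le (inj₁ o)                 = inj₁ o
  Pre-mono le (inj₂ (inj₁ e))          = inj₂ (inj₁ e)
  Pre-mono le (inj₂ (inj₂ (a , low)))  = inj₂ (inj₂ (a , λ k lt → low k (≤-<-trans le lt)))

  Pre-upd : ∀ {odd pos m i r s} → r ≤ m → Pre odd pos m s → Pre odd (upd pos i r) m s
  Pre-upd le (inj₁ o)                 = inj₁ o
  Pre-upd le (inj₂ (inj₁ e))          = inj₂ (inj₁ e)
  Pre-upd {pos = pos} le (inj₂ (inj₂ (a , low))) = inj₂ (inj₂ (a , Low-upd pos le low))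

  -- `live` is for runs on the path, `entry` for arrivals at demanded positions. `skipped` concerns
  -- the target of a skip: a demand there forces the next block to be the single one, whose slot
  -- succeeds from every state. This is why `done` survives a slot `+out.set:0`, which clears `out`
  -- but also skips.
  record Sound (odd : Bool) (pos dem : ℕ → ℕ) (Y : List Prim) : Set where
    field
      done    : ∀ s → outR s ≡ true → run Y 0 s ≡ just true
      done₁   : ∀ s → outR s ≡ true → 2 ≤ length Y → run Y 1 s ≡ just true
      live    : ∀ s v → Fresh n pos v → inR s v ≡ true → odd ≡ false ⊎ (AuxOk s × Low 0 pos (inR s)) →
                run Y 0 s ≡ just true
      entry   : ∀ x s → x < length Y → 0 < dem (length Y ∸ x) → Pre odd pos (dem (length Y ∸ x)) s →
                run Y x s ≡ just true
      skipped : 2 ≤ length Y → 0 < dem (length Y ∸ 1) →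
                odd ≡ true × (∀ s → run Y 1 s ≡ just true) ×
                (∀ s v → Fresh n pos v → inR s v ≡ true → run Y 0 s ≡ just true)
      blank   : ∀ s → (∀ v → Fresh n pos v → inR s v ≡ false) → run Y 0 s ≡ just (outR s)
  open Sound

  slot-sound : ∀ {odd pos dem m z dem' Y} → SlotOk n pos dem m (length Y) z dem' →
               Sound odd pos dem' Y → ValidPrim z → auxIndex z ≤ K → 0 < m →
               ∀ s → Pre odd pos m s → run (z ∷ Y) 0 s ≡ just true
  slot-sound set      S vz ax m>0 s p = done S _ refl
  slot-sound +set     S vz ax m>0 s p = done S _ refl
  slot-sound (-set l) S vz ax m>0 s p = done₁ S _ refl l
  slot-sound {dem = dem} {m} (link {l} lt) S vz ax m>0 s p =
    entry S l s lt (<-≤-trans m>0 (demand-hit-≥ dem _ m)) (Pre-mono (demand-hit-≥ dem _ m) p)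
  slot-sound {odd} {dem = dem} {m} {z} {Y = Y} (skip k l) S vz ax m>0 s p
    with skipped S l (<-≤-trans m>0 (demand-hit-≥ dem _ m))
  ... | refl , one , two = go k vz ax p
    where
    go : ∀ {z} → Skip z → ValidPrim z → auxIndex z ≤ K → Pre true _ m s → run (z ∷ Y) 0 s ≡ just true
    go +out0 vz ax p = one _
    go +aux0 vz ax p = one _
    go -aux1 vz ax p = one _
    -- The reply 1 falls through to the next block: harmless if `out` is 1, and otherwise excluded
    -- by `AuxOk`.
    go (+aux {k}) vz ax p with auxR s k in eq
    ... | false = one _
    ... | true with p
    ...   | inj₁ o = done S s o
    ...   | inj₂ (inj₂ (a , _)) with () ← trans (sym eq) (a k vz ax)
  slot-sound {odd} {pos = pos} {dem = dem} {m} (skipIn {k} l vk) S vz ax m>0 s p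
    with skipped S l (<-≤-trans m>0 (demand-hit-≥ dem _ m))
  ... | refl , one , two with inR s k in eq
  ...   | false = one _
  ...   | true with vk
  ...     | inj₁ (z , k≤n) = two s k (fresh vz k≤n z) eq
  ...     | inj₂ lt with p
  ...       | inj₁ o = done S s o
  ...       | inj₂ (inj₂ (_ , low)) with () ← trans (sym eq) (low k lt)

  absurd₀ : ∀ {d : ℕ} → d ≡ 0 → ¬ 0 < d
  absurd₀ refl ()

  -- The length equation is carried along for the final `!`, where it shows that no variable is left
  -- unread. `Floor` keeps the tests of the current block out of the `Low` condition of entries that
  -- land behind it.
  sound : ∀ {odd pos dem} Y → Acc n odd pos dem Y → All ValidPrim Y → All (λ z → auxIndex z ≤ K) Y →
          2 * length Y ≡ 3 * count n pos + 2 + bit odd → Floor (length Y) dem → Sound odd pos dem Y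
  sound {odd} {pos} {dem} (halt ∷ []) (stop d0) V A eq fl = record
    { done    = λ s → cong just
    ; done₁   = λ { s o (s≤s ()) }
    ; live    = λ s v f _ _ → ⊥-elim (count-zero n pos c0 v f)
    ; entry   = λ { zero s _ lt _ → ⊥-elim (absurd₀ d0 lt) ; (suc x) s (s≤s ()) lt _ }
    ; skipped = λ { (s≤s ()) }
    ; blank   = λ s _ → refl
    }
    where
    c0 = tight-end (count n pos) (bit odd) eq
  sound {odd} {pos} {dem} (ntest (inGet i) ∷ ptest (inGet j) ∷ z ∷ Y)
        (pair {dem' = dem'} i≤n pi d0 j≤n pj d1 ok acc) (vi ∷ vj ∷ vz ∷ V) (_ ∷ _ ∷ az ∷ A) eq fl = record
    { done    = D
    ; done₁   = D₁
    ; live    = live'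
    ; entry   = entry'
    ; skipped = λ _ lt → ⊥-elim (absurd₀ d1 lt)
    ; blank   = blank'
    }
    where
    r = 3 + length Y
    pos₁ = upd pos i r
    pos₂ = upd pos₁ j r
    m = dem (1 + length Y) ⊔ r
    r≤m : r ≤ m
    r≤m = m≤n⊔m (dem (1 + length Y)) r
    Y≤m : length Y ≤ m
    Y≤m = ≤-trans (m≤n+m (length Y) 3) r≤m
    fi : Fresh n pos i
    fi = fresh vi i≤n pi
    fj : Fresh n pos₁ j
    fj = fresh vj j≤n pj
    S : Sound odd pos₂ dem' Y
    S = sound Y acc V A (pair-eq n pos i j (length Y) (bit odd) fi fj eq)
          (slot-floor Y≤m (λ a lt → ≤-trans (m≤n+m (length Y) 3) (fl a lt)) ok)
    slot : ∀ s → Pre odd pos₂ m s → run (z ∷ Y) 0 s ≡ just true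
    slot = slot-sound ok S vz az (<-≤-trans z<s r≤m)
    D₁ : ∀ s → outR s ≡ true → 2 ≤ r → run (ptest (inGet j) ∷ z ∷ Y) 0 s ≡ just true
    D₁ s o _ with inR s j
    ... | true  = slot s (inj₁ o)
    ... | false = done S s o
    D : ∀ s → outR s ≡ true → run (ntest (inGet i) ∷ ptest (inGet j) ∷ z ∷ Y) 0 s ≡ just true
    D s o with inR s i
    ... | true  = slot s (inj₁ o)
    ... | false = D₁ s o (s≤s (s≤s z≤n))
    pre : ∀ s → odd ≡ false ⊎ (AuxOk s × Low 0 pos (inR s)) → Pre odd pos₂ m s
    pre s (inj₁ e)         = inj₂ (inj₁ e)
    pre s (inj₂ (a , low)) = inj₂
        (inj₂ (a , Low-upd pos₁ r≤m (Low-upd pos r≤m (λ k lt → low k (≤-<-trans z≤n lt)))))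
    live' : ∀ s v → Fresh n pos v → inR s v ≡ true → odd ≡ false ⊎ (AuxOk s × Low 0 pos (inR s)) →
            run (ntest (inGet i) ∷ ptest (inGet j) ∷ z ∷ Y) 0 s ≡ just true
    live' s v f bv h with inR s i in bi
    ... | true  = slot s (pre s h)
    ... | false with inR s j in bj
    ...   | true  = slot s (pre s h)
    ...   | false = live S s v (fresh (Fresh.low f) (Fresh.high f)
                     (trans (upd-other pos₁ r (differ bj))
                         (trans (upd-other pos r (differ bi)) (Fresh.unread f)))) bv
                     (map₂ (λ (a , low) → a , Low-read pos₁ bj (Low-read pos bi low)) h)
      where
      differ : ∀ {k} → inR s k ≡ false → v ≢ k
      differ b refl with () ← trans (sym bv) b
    entry' : ∀ x s → x < r → 0 < dem (r ∸ x) → Pre odd pos (dem (r ∸ x)) s →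
             run (ntest (inGet i) ∷ ptest (inGet j) ∷ z ∷ Y) x s ≡ just true
    entry' 0 s _ lt p = ⊥-elim (absurd₀ d0 lt)
    entry' 1 s _ lt p = ⊥-elim (absurd₀ d1 lt)
    -- Both variables of this block get position `r ≤ m`, so `Low m` says nothing new about them.
    entry' 2 s _ lt p = slot s (Pre-upd r≤m (Pre-upd r≤m (Pre-mono (m≤m⊔n _ r) p)))
    entry' (suc (suc (suc x))) s (s≤s (s≤s (s≤s x<))) lt p =
      entry S x s x< (<-≤-trans lt mono) (Pre-mono mono (Pre-upd q (Pre-upd q p)))
      where
      mono = slot-≥ ok (length Y ∸ x)
      q : r ≤ dem (length Y ∸ x)
      q = fl (length Y ∸ x) lt
    blank' : ∀ s → (∀ v → Fresh n pos v → inR s v ≡ false) → run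
        (ntest (inGet i) ∷ ptest (inGet j) ∷ z ∷ Y) 0 s ≡ just (outR s)
    blank' s zs rewrite zs i fi | zs j (proj₂ (Fresh-upd {r = r} z<s fj)) =
      blank S s (λ v f → zs v (proj₂ (Fresh-upd {r = r} z<s (proj₂ (Fresh-upd {r = r} z<s f)))))
  sound {.true} {pos} {dem} (ptest (inGet i) ∷ z ∷ Y)
        (single {dem' = dem'} i≤n pi d0 ok acc) (vi ∷ vz ∷ V) (_ ∷ az ∷ A) eq fl = record
    { done    = D
    ; done₁   = λ s _ _ → slot s
    ; live    = λ s v f bv _ → alive s v f bv
    ; entry   = entry'
    ; skipped = λ _ _ → refl , slot , alive
    ; blank   = blank'
    }
    where
    r = 2 + length Y
    pos₁ = upd pos i r
    m = dem (1 + length Y) ⊔ r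
    r≤m : r ≤ m
    r≤m = m≤n⊔m (dem (1 + length Y)) r
    fi : Fresh n pos i
    fi = fresh vi i≤n pi
    S : Sound false pos₁ dem' Y
    S = sound Y acc V A (single-eq n pos i (length Y) fi eq)
          (slot-floor (≤-trans (m≤n+m (length Y) 2) r≤m) (λ a lt → ≤-trans (m≤n+m (length Y) 2) (fl a lt)) ok)
    slot : ∀ s → run (z ∷ Y) 0 s ≡ just true
    slot s = slot-sound ok S vz az (<-≤-trans z<s r≤m) s (inj₂ (inj₁ refl))
    D : ∀ s → outR s ≡ true → run (ptest (inGet i) ∷ z ∷ Y) 0 s ≡ just true
    D s o with inR s i
    ... | true  = slot s
    ... | false = done S s o
    alive : ∀ s v → Fresh n pos v → inR s v ≡ true → run (ptest (inGet i) ∷ z ∷ Y) 0 s ≡ just true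
    alive s v f bv with inR s i in bi
    ... | true  = slot s
    ... | false = live S s v
          (fresh (Fresh.low f) (Fresh.high f) (trans (upd-other pos r differ) (Fresh.unread f))) bv (inj₁ refl)
      where
      differ : v ≢ i
      differ refl with () ← trans (sym bv) bi
    entry' : ∀ x s → x < r → 0 < dem (r ∸ x) → Pre true pos (dem (r ∸ x)) s →
             run (ptest (inGet i) ∷ z ∷ Y) x s ≡ just true
    entry' 0 s _ lt p = ⊥-elim (absurd₀ d0 lt)
    entry' 1 s _ lt p = slot s
    entry' (suc (suc x)) s (s≤s (s≤s x<)) lt p =
      entry S x s x< (<-≤-trans lt (slot-≥ ok (length Y ∸ x))) (inj₂ (inj₁ refl))
    blank' : ∀ s → (∀ v → Fresh n pos v → inR s v ≡ false) → run (ptest (inGet i) ∷ z ∷ Y) 0 s ≡ just (outR s)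
    blank' s zs rewrite zs i fi = blank S s (λ v f → zs v (proj₂ (Fresh-upd {r = r} z<s f)))

-- Tiling

zeros : ℕ → Bool
zeros _ = false

point : ℕ → ℕ → Bool
point v j = j ≡ᵇ v

point-other : ∀ {v j} → v ≢ j → point v j ≡ false
point-other ne = ≢⇒≡ᵇ (ne ∘ sym)

module _ (n : ℕ) where

  -- The zero input and the inputs with a single 1 at an unread variable have received the same
  -- replies so far, hence one common `o` and `a` describes all these runs.
  record Disc (pos : ℕ → ℕ) (Y : List Prim) (o : Bool) (a : ℕ → Bool) : Set where
    constructor disc
    field
      zer : run Y 0 (mkState zeros o a) ≡ just false
      one : ∀ v → Fresh n pos v → run Y 0 (mkState (point v) o a) ≡ just true
  open Disc

  -- `slack₁` spends an instruction without learning anything, `slack₃` spends three on one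
  -- variable. In `nhaltS` the zero input stops at `!`, so no variable other than `i` can still be
  -- unread.
  data Step (pos : ℕ → ℕ) : List Prim → Bool → (ℕ → Bool) → Set where
    haltS  : ∀ {Y o a} → count n pos ≡ 0 → Step pos (halt ∷ Y) o a
    nhaltS : ∀ {i Y o a} → count n pos ≡ 0 ⊎ (count n pos ≤ 1 × run Y 0 (mkState (point i) o a) ≡ just true) →
             Step pos (ntest (inGet i) ∷ halt ∷ Y) o a
    slack₁ : ∀ {Y Y' o a o' a'} → length Y' < length Y → Disc pos Y' o' a' → Step pos Y o a
    slack₃ : ∀ {i r Y Y' o a o' a'} → 0 < r → 3 + length Y' ≤ length Y → Disc (upd pos i r) Y' o' a' →
        Step pos Y o a
    singleS : ∀ {i z Y o a} → Disc (upd pos i (2 + length Y)) Y o a → Step pos (ptest (inGet i) ∷ z ∷ Y) o a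
    -- The instruction x bypassed on reply 1 can at most change out and auxiliary registers,
    -- which the tight remainder Y never inspects.
    bypassS : ∀ {i x Y o a o' a'} → Disc (upd pos i (2 + length Y)) Y o' a' →
              (Fresh n pos i → run Y 0 (mkState (point i) o a) ≡ just true) →
              Step pos (ntest (inGet i) ∷ x ∷ Y) o a
    pairS  : ∀ {i j z Y o a} → Disc (upd (upd pos i (3 + length Y)) j (3 + length Y)) Y o a →
             Step pos (ntest (inGet i) ∷ ptest (inGet j) ∷ z ∷ Y) o a

  Disc-drop : ∀ {pos Y o a} k → run Y k (mkState zeros o a) ≡ just false →
              (∀ v → Fresh n pos v → run Y k (mkState (point v) o a) ≡ just true) →
              Disc pos (drop k Y) o a
  Disc-drop {Y = Y} k z e = disc (trans (sym (run-drop k Y _)) z) (λ v f → trans (sym (run-drop k Y _)) (e v f))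

  slackDrop : ∀ {pos x Y o a o' a'} k → run Y k (mkState zeros o' a') ≡ just false →
              (∀ v → Fresh n pos v → run Y k (mkState (point v) o' a') ≡ just true) →
              Step pos (x ∷ Y) o a
  slackDrop {Y = Y} k z e = slack₁ (s≤s (length-drop-≤ k Y)) (Disc-drop k z e)

  slackTest : ∀ {pos x Y o a o' a'} c p q →
              (if c then run Y p (mkState zeros o' a') else run Y q (mkState zeros o' a')) ≡ just false →
              (∀ v → Fresh n pos v →
                (if c then run Y p (mkState (point v) o' a') else run Y q
                    (mkState (point v) o' a')) ≡ just true) →
              Step pos (x ∷ Y) o a
  slackTest true  p q z e = slackDrop p z e
  slackTest false p q z e = slackDrop q z e

  bypassTest : ∀ {pos i x Y o a o' a'} k → run Y k (mkState zeros o' a') ≡ just false →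
               (∀ v → v ≢ i × Fresh n pos v → run Y k (mkState (point v) o' a') ≡ just true) →
               (Fresh n pos i → run Y 0 (mkState (point i) o a) ≡ just true) →
               Step pos (ntest (inGet i) ∷ x ∷ Y) o a
  bypassTest {Y = Y}     zero    z e b = bypassS (disc z (λ v f → e v (Fresh-upd z<s f))) b
  bypassTest {i = i} {Y = y ∷ Y} (suc k) z e b =
    -- Any positive number marks `i` as read. The test, `x` and at least one instruction of the
    -- remainder are gone, three in all for one variable.
    slack₃ {i = i} {r = 1} z<s (s≤s (s≤s (s≤s (length-drop-≤ k Y))))
        (Disc-drop k z (λ v f → e v (Fresh-upd {r = 1} z<s f)))

  bypassIf : ∀ {pos i x Y o a o' a'} c p q →
             (if c then run Y p (mkState zeros o' a') else run Y q (mkState zeros o' a')) ≡ just false →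
             (∀ v → v ≢ i × Fresh n pos v →
               (if c then run Y p (mkState (point v) o' a') else run Y q
                   (mkState (point v) o' a')) ≡ just true) →
             (Fresh n pos i → run Y 0 (mkState (point i) o a) ≡ just true) →
             Step pos (ntest (inGet i) ∷ x ∷ Y) o a
  bypassIf true  p q z e b = bypassTest p z e b
  bypassIf false p q z e b = bypassTest q z e b

  past : ∀ {pos i Y o a} → Disc pos (ntest (inGet i) ∷ Y) o a →
         ∀ v → v ≢ i × Fresh n pos v → run Y 0 (mkState (point v) o a) ≡ just true
  past {i = i} {Y} {o} {a} d v (ne , f) =
    trans (sym (if-false (point-other ne))) (one d v f)

  over : ∀ {pos i x Y o a} → Disc pos (ntest (inGet i) ∷ x ∷ Y) o a →
         Fresh n pos i → run Y 0 (mkState (point i) o a) ≡ just true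
  over {i = i} {x} {Y} {o} {a} d f =
    trans (sym (if-true (≡ᵇ-refl i))) (one d i f)

  -- An instruction that is no input test replies the same on all inputs compared, so it can be
  -- executed and dropped. The work lies in the input tests, in particular in what follows `-in:i`.
  step : ∀ {pos} Y {o a} → Disc pos Y o a → Step pos Y o a
  step (plain (inGet i) ∷ Y)    d = slackDrop 0 (zer d) (one d)
  step (plain (outSet b) ∷ Y)   d = slackDrop 0 (zer d) (one d)
  step (plain (auxGet i) ∷ Y)   d = slackDrop 0 (zer d) (one d)
  step (plain (auxSet i b) ∷ Y) d = slackDrop 0 (zer d) (one d)
  step (ptest (outSet b) ∷ Y)   d = slackTest b 0 1 (zer d) (one d)
  step (ptest (auxGet i) ∷ Y) {a = a} d = slackTest (a i) 0 1 (zer d) (one d)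
  step (ptest (auxSet i b) ∷ Y) d = slackTest b 0 1 (zer d) (one d)
  step (ntest (outSet b) ∷ Y)   d = slackTest b 1 0 (zer d) (one d)
  step (ntest (auxGet i) ∷ Y) {a = a} d = slackTest (a i) 1 0 (zer d) (one d)
  step (ntest (auxSet i b) ∷ Y) d = slackTest b 1 0 (zer d) (one d)
  step (jump (suc l) ∷ Y)       d = slackDrop l (zer d) (one d)
  step {pos} (halt ∷ Y)         d with count-find n pos
  ... | inj₁ c       = haltS c
  ... | inj₂ (v , f) with () ← trans (sym (zer d)) (one d v f)
  step {pos} (ptest (inGet i) ∷ z ∷ Y) {o} {a} d = singleS (disc (zer d) rest)
    where
    rest : ∀ v → Fresh n (upd pos i (2 + length Y)) v → run Y 0 (mkState (point v) o a) ≡ just true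
    rest v f with Fresh-upd {r = 2 + length Y} z<s f
    ... | ne , f' = trans (sym (if-false (point-other ne))) (one d v f')
  step {pos} (ntest (inGet i) ∷ plain (inGet j) ∷ Y)    d = bypassTest 0 (zer d) (past d) (over d)
  step {pos} (ntest (inGet i) ∷ plain (outSet b) ∷ Y)   d = bypassTest 0 (zer d) (past d) (over d)
  step {pos} (ntest (inGet i) ∷ plain (auxGet j) ∷ Y)   d = bypassTest 0 (zer d) (past d) (over d)
  step {pos} (ntest (inGet i) ∷ plain (auxSet j b) ∷ Y) d = bypassTest 0 (zer d) (past d) (over d)
  step {pos} (ntest (inGet i) ∷ ptest (outSet b) ∷ Y)   d = bypassIf b 0 1 (zer d) (past d) (over d)
  step {pos} (ntest (inGet i) ∷ ptest (auxGet j) ∷ Y) {a = a} d = bypassIf (a j) 0 1 (zer d) (past d) (over d)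
  step {pos} (ntest (inGet i) ∷ ptest (auxSet j b) ∷ Y) d = bypassIf b 0 1 (zer d) (past d) (over d)
  step {pos} (ntest (inGet i) ∷ ntest (outSet b) ∷ Y)   d = bypassIf b 1 0 (zer d) (past d) (over d)
  step {pos} (ntest (inGet i) ∷ ntest (auxGet j) ∷ Y) {a = a} d = bypassIf (a j) 1 0 (zer d) (past d) (over d)
  step {pos} (ntest (inGet i) ∷ ntest (auxSet j b) ∷ Y) d = bypassIf b 1 0 (zer d) (past d) (over d)
  step {pos} (ntest (inGet i) ∷ jump (suc l) ∷ Y)       d = bypassTest l (zer d) (past d) (over d)
  step {pos} (ntest (inGet i) ∷ ptest (inGet j) ∷ z ∷ Y) {o} {a} d = pairS (disc (zer d) rest)
    where
    r = 3 + length Y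
    rest : ∀ v → Fresh n (upd (upd pos i r) j r) v → run Y 0 (mkState (point v) o a) ≡ just true
    rest v f with Fresh-upd {r = r} z<s f
    ... | nj , f' = trans (sym (if-false (point-other nj))) (past d v (Fresh-upd {r = r} z<s f'))
  -- Whatever the first test replies, the second one is either skipped or has no effect.
  step {pos} (ntest (inGet i) ∷ ntest (inGet j) ∷ Y) {o} {a} d with i ≟ j
  ... | yes refl = slack₁ {Y' = Y} (s≤s (n≤1+n _)) (disc (zer d) rest)
    where
    rest : ∀ v → Fresh n pos v → run Y 0 (mkState (point v) o a) ≡ just true
    rest v f with v ≟ i
    ... | yes refl = over d f
    ... | no ne    = trans (sym (if-false (point-other ne))) (past d v (ne , f))
  ... | no i≢j = slack₁ {Y' = ntest (inGet j) ∷ Y} ≤-refl (disc (zer d) rest)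
    where
    rest : ∀ v → Fresh n pos v → run (ntest (inGet j) ∷ Y) 0 (mkState (point v) o a) ≡ just true
    rest v f with v ≟ i
    ... | yes refl = trans (if-false (point-other i≢j)) (over d f)
    ... | no ne    = past d v (ne , f)
  step {pos} (ntest (inGet i) ∷ halt ∷ Y) {o} {a} d = nhaltS help
    where
    -- Another unread `v` would pass the test with reply 0 and stop at the same `!` as the zero
    -- input.
    only : ∀ v → Fresh n pos v → v ≡ i
    only v f with v ≟ i
    ... | yes e = e
    ... | no ne with () ← trans (sym (past d v (ne , f))) (zer d)
    help : count n pos ≡ 0 ⊎ (count n pos ≤ 1 × run Y 0 (mkState (point i) o a) ≡ just true)
    help with count-find n pos
    ... | inj₁ c = inj₁ c
    ... | inj₂ (v , f) with only v f
    ...   | refl = inj₂ (subst (_≤ 1) (sym (count-fresh n pos i {1} z<s f)) (s≤s (≤-reflexive none)) , over d f)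
      where
      none : count n (upd pos i 1) ≡ 0
      none with count-find n (upd pos i 1)
      ... | inj₁ c = c
      ... | inj₂ (w , g) with Fresh-upd {r = 1} z<s g
      ...   | ne , g' = ⊥-elim (ne (only w g'))

  -- One unread variable costs two instructions on its own, two together cost three; the excess e is wasted.
  gain : ∀ g k e {c c' y y'} → 3 * g + e ≤ 2 * k → c ≤ g + c' → k + y' ≤ y → 3 * c' + 2 ≤ 2 * y' →
      3 * c + 2 + e ≤ 2 * y
  gain g k e {c} {c'} {y} {y'} le₁ le₂ le₃ le₄ = begin
    3 * c + 2 + e                ≤⟨ +-monoˡ-≤ e (+-monoˡ-≤ 2 (*-monoʳ-≤ 3 le₂)) ⟩
    3 * (g + c') + 2 + e         ≡⟨ lem g c' e ⟩
    (3 * g + e) + (3 * c' + 2)   ≤⟨ +-mono-≤ le₁ le₄ ⟩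
    2 * k + 2 * y'               ≡⟨ sym (*-distribˡ-+ 2 k y') ⟩
    2 * (k + y')                 ≤⟨ *-monoʳ-≤ 2 le₃ ⟩
    2 * y                        ∎
    where
    open ≤-Reasoning
    lem : ∀ g c e → 3 * (g + c) + 2 + e ≡ (3 * g + e) + (3 * c + 2)
    lem = solve-∀

  weaken : ∀ c y e → 3 * c + 2 + e ≤ 2 * y → 3 * c + 2 ≤ 2 * y
  weaken c y e = ≤-trans (m≤m+n _ e)

  count-upd₂ : ∀ pos i j {r} → 0 < r → count n pos ≤ 2 + count n (upd (upd pos i r) j r)
  count-upd₂ pos i j r>0 = ≤-trans (count-upd n pos i r>0) (s≤s (count-upd n (upd pos i _) j r>0))

  -- Each constructor of `Step` that leaves a remainder spends at least three halves of an
  -- instruction per variable read. Since these remainders are of varying length, the recursion runs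
  -- on the bound `f`.
  bound : ∀ f {pos} Y {o a} → length Y ≤ f → Disc pos Y o a → 3 * count n pos + 2 ≤ 2 * length Y

  -- The step reads at most `g` variables, spends at least `suc k` instructions and therefore wastes
  -- `e` units of the doubled length.
  bound-slack : ∀ f {pos Y Y' o a} g k e → 3 * g + e ≤ 2 * suc k → length Y ≤ suc f →
                suc k + length Y' ≤ length Y → ∀ {pos'} → count n pos ≤ g + count n pos' → Disc pos' Y' o a →
                3 * count n pos + 2 + e ≤ 2 * length Y
  bound-slack f {Y' = Y'} g k e le₁ le₃ le₄ c d =
    gain g (suc k) e le₁ c le₄ (bound f Y' (s≤s⁻¹ (≤-trans (≤-trans (s≤s (m≤n+m _ k)) le₄) le₃)) d)

  bound zero []    le d with () ← zer d
  bound (suc f) {pos} Y le d with step Y d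
  bound (suc f) (_ ∷ Y) le d | haltS c rewrite c = *-monoʳ-≤ 2 {1} {suc (length Y)} (s≤s z≤n)
  bound (suc f) (_ ∷ _ ∷ Y) le d | nhaltS (inj₁ c) rewrite c = *-monoʳ-≤ 2 {1} {2 + length Y} (s≤s z≤n)
  bound (suc f) (_ ∷ _ ∷ Y) le d | nhaltS (inj₂ (c , e)) =
    ≤-trans (≤-trans (+-monoˡ-≤ 2 (*-monoʳ-≤ 3 c)) (n≤1+n 5))
        (*-monoʳ-≤ 2 (s≤s (s≤s (≤-<-trans z≤n (run-short Y 0 _ e)))))
  bound (suc f) {pos} Y le d | slack₁ {Y' = Y'} lt d' =
    weaken (count n pos) (length Y) 2 (bound-slack f {pos} {Y} 0 0 2 (≤ᵇ⇒≤ _ _ _) le lt ≤-refl d')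
  bound (suc f) {pos} Y le d | slack₃ {i} {Y' = Y'} r>0 lt d' =
    weaken (count n pos) (length Y) 3
        (bound-slack f {pos} {Y} 1 2 3 (≤ᵇ⇒≤ _ _ _) le lt (count-upd n pos i r>0) d')
  bound (suc f) {pos} Y le d | singleS {i} d' =
    weaken (count n pos) (length Y) 1
        (bound-slack f {pos} {Y} 1 1 1 (≤ᵇ⇒≤ _ _ _) le ≤-refl (count-upd n pos i z<s) d')
  bound (suc f) {pos} Y le d | bypassS {i} d' _ =
    weaken (count n pos) (length Y) 1
        (bound-slack f {pos} {Y} 1 1 1 (≤ᵇ⇒≤ _ _ _) le ≤-refl (count-upd n pos i z<s) d')
  bound (suc f) {pos} Y le d | pairS {i} {j} d' =
    weaken (count n pos) (length Y) 0
        (bound-slack f {pos} {Y} 2 2 0 (≤ᵇ⇒≤ _ _ _) le ≤-refl (count-upd₂ pos i j z<s) d')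

  data Tiled : Bool → (ℕ → ℕ) → List Prim → Set where
    stop   : ∀ {pos} → Tiled false pos (halt ∷ [])
    pair   : ∀ {odd pos i j z Y} → let r = 3 + length Y in
             Fresh n pos i → Fresh n (upd pos i r) j → Tiled odd (upd (upd pos i r) j r) Y →
             Tiled odd pos (ntest (inGet i) ∷ ptest (inGet j) ∷ z ∷ Y)
    single : ∀ {pos i z Y} → Fresh n pos i → Tiled false (upd pos i (2 + length Y)) Y →
             Tiled true pos (ptest (inGet i) ∷ z ∷ Y)

  Blank : (ℕ → ℕ) → (ℕ → Bool) → Set
  Blank pos b = ∀ v → Fresh n pos v → b v ≡ false

  Blank-upd : ∀ {pos i r b} → 0 < r → Blank pos b → Blank (upd pos i r) b
  Blank-upd r>0 bl v f = bl v (proj₂ (Fresh-upd r>0 f))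

  -- The path never executes a slot, so nothing on it writes a register.
  blank-run : ∀ {odd pos Y} → Tiled odd pos Y → ∀ b o a → Blank pos b → run Y 0 (mkState b o a) ≡ just o
  blank-run stop b o a bl = refl
  blank-run (pair {pos = pos} {i} {j} {Y = Y} fi fj t) b o a bl
    rewrite bl i fi | bl j (proj₂ (Fresh-upd z<s fj)) = blank-run t b o a
        (Blank-upd {upd pos i (3 + length Y)} {j} {b = b} z<s (Blank-upd {pos} {i} {b = b} z<s bl))
  blank-run (single {pos = pos} {i} fi t) b o a bl rewrite bl i fi = blank-run t b o a
      (Blank-upd {pos} {i} {b = b} z<s bl)

  -- With no single block ahead, skipping one instruction leads to the `+in:j` of a pair, hence back
  -- onto the path, or past the final `!`.
  blank-run₁ : ∀ {pos Y} → Tiled false pos Y → ∀ b a → Blank pos b → run Y 1 (mkState b false a) ≢ just true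
  blank-run₁ (pair {pos = pos} {i} {j} {Y = Y} fi fj t) b a bl eq
    rewrite bl j (proj₂ (Fresh-upd z<s fj))
    with () ← trans (sym eq)
        (blank-run t b false a
            (Blank-upd {upd pos i (3 + length Y)} {j} {b = b} z<s (Blank-upd {pos} {i} {b = b} z<s bl)))

  point-blank : ∀ {pos i} → (∀ v → Fresh n pos v → v ≢ i) → Blank pos (point i)
  point-blank h v f = point-other (h v f ∘ sym)

  -- All steps wasting more than `bit odd` contradict `bound`. For `odd` the steps `bypassS` and
  -- `nhaltS` need more: there the branch with `in:i` = 1 still has `out` = 0, which is the purpose
  -- of the condition on `o`.
  tile : ∀ f odd {pos} Y {o a} → length Y ≤ f → Disc pos Y o a → (odd ≡ true → o ≡ false) →
         2 * length Y ≡ 3 * count n pos + 2 + bit odd → Tiled odd pos Y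

  bit≤1 : ∀ b → bit b ≤ 1
  bit≤1 true  = ≤-refl
  bit≤1 false = z≤n

  excess : ∀ {c y odd} e → bit odd < e → 2 * y ≡ 3 * c + 2 + bit odd → 3 * c + 2 + e ≤ 2 * y → ⊥
  excess {c} e lt eq le = <⇒≱ (+-monoʳ-< (3 * c + 2) lt) (≤-trans le (≤-reflexive eq))

  wasteful : ∀ f odd {pos} Y {Y' o a} g k e → bit odd < e → 3 * g + e ≤ 2 * suc k → length Y ≤ suc f →
             suc k + length Y' ≤ length Y → ∀ {pos'} → count n pos ≤ g + count n pos' → Disc pos' Y' o a →
             2 * length Y ≡ 3 * count n pos + 2 + bit odd → ⊥
  wasteful f odd {pos} Y g k e lt le₁ le₂ le₃ c d eq =
    excess {count n pos} {length Y} {odd} e lt eq (bound-slack f {pos} {Y} g k e le₁ le₂ le₃ c d)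

  tile zero odd [] le d h eq with () ← zer d
  tile (suc f) odd {pos} Y le d h eq with step Y d
  tile (suc f) false (_ ∷ []) le d h eq | haltS c = stop
  tile (suc f) true {pos} (_ ∷ []) le d h eq | haltS c with () ← trans eq (cong (λ c → 3 * c + 2 + 1) c)
  tile (suc f) odd {pos} (_ ∷ _ ∷ Y) le d h eq | haltS c =
    ⊥-elim (excess {c = 0} {y = 2 + length Y} {odd} 2 (s≤s (bit≤1 odd))
        (trans eq (cong (λ c → 3 * c + 2 + bit odd) c)) (*-monoʳ-≤ 2 (s≤s (s≤s z≤n))))
  tile (suc f) odd {pos} (_ ∷ _ ∷ Y) le d h eq | nhaltS (inj₁ c) =
    ⊥-elim (excess {c = 0} {y = 2 + length Y} {odd} 2 (s≤s (bit≤1 odd))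
        (trans eq (cong (λ c → 3 * c + 2 + bit odd) c)) (*-monoʳ-≤ 2 (s≤s (s≤s z≤n))))
  tile (suc f) odd {pos} (_ ∷ _ ∷ Y) {o} {a} le d h eq | nhaltS {i} (inj₂ (c , e)) = ⊥-elim (wasted odd h eq)
    where
    wasted : ∀ odd → (odd ≡ true → o ≡ false) → 2 * (2 + length Y) ≡ 3 * count n pos + 2 + bit odd → ⊥
    wasted false h eq = excess {c = count n pos} {y = 2 + length Y} {false} 1 z<s eq
      (≤-trans (+-monoˡ-≤ 1 (+-monoˡ-≤ 2 (*-monoʳ-≤ 3 c)))
          (*-monoʳ-≤ 2 (s≤s (s≤s (≤-<-trans z≤n (run-short Y 0 _ e))))))
    -- Here `Y` itself has to set `out` and stop, so at least four instructions serve at most one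
    -- variable: 8 = 3 + 2 + 3.
    wasted true h eq = excess {c = count n pos} {y = 2 + length Y} {true} 3 (s≤s (s≤s z≤n)) eq
      (≤-trans (+-monoˡ-≤ 3 (+-monoˡ-≤ 2 (*-monoʳ-≤ 3 c)))
          (*-monoʳ-≤ 2 {4} (s≤s (s≤s (run-set Y _ (h refl) e)))))
  tile (suc f) odd {pos} Y le d h eq | slack₁ lt d' =
    ⊥-elim (wasteful f odd Y 0 0 2 (s≤s (bit≤1 odd)) (≤ᵇ⇒≤ _ _ _) le lt ≤-refl d' eq)
  tile (suc f) odd {pos} Y le d h eq | slack₃ {i} r>0 lt d' =
    ⊥-elim (wasteful f odd Y 1 2 3 (s≤s (m≤n⇒m≤1+n (bit≤1 odd))) (≤ᵇ⇒≤ _ _ _) le lt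
        (count-upd n pos i r>0) d' eq)
  tile (suc f) false {pos} Y le d h eq | singleS {i} d' =
    ⊥-elim (wasteful f false Y 1 1 1 ≤-refl (≤ᵇ⇒≤ _ _ _) le ≤-refl (count-upd n pos i z<s) d' eq)
  tile (suc f) false {pos} Y le d h eq | bypassS {i} d' _ =
    ⊥-elim (wasteful f false Y 1 1 1 ≤-refl (≤ᵇ⇒≤ _ _ _) le ≤-refl (count-upd n pos i z<s) d' eq)
  tile (suc f) true {pos} Y@(_ ∷ _ ∷ Y') le d h eq | singleS {i} d' with fresh? n pos i
  ... | no nf = ⊥-elim (wasteful f true Y 0 1 4 (s≤s (s≤s z≤n)) (≤ᵇ⇒≤ _ _ _) le ≤-refl
                  (≤-reflexive (sym (count-stale n pos i z<s nf))) d' eq)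
  ... | yes fi = single fi
        (tile f false Y' (≤-trans (n≤1+n _) (s≤s⁻¹ le)) d' (λ ()) (single-eq n pos i (length Y') fi eq))
  tile (suc f) true {pos} Y@(_ ∷ _ ∷ Y') {o} {a} le d h eq | bypassS {i} d' e with fresh? n pos i
  ... | no nf = ⊥-elim (wasteful f true Y 0 1 4 (s≤s (s≤s z≤n)) (≤ᵇ⇒≤ _ _ _) le ≤-refl
                  (≤-reflexive (sym (count-stale n pos i z<s nf))) d' eq)
  ... | yes fi with tile f false Y' (≤-trans (n≤1+n _) (s≤s⁻¹ le)) d' (λ ())
        (single-eq n pos i (length Y') fi eq)
  -- On reply 1 the run enters a tiled remainder in which `i` is no longer tested on the path, so it
  -- ends with `out` unchanged.
  ...   | t with () ← trans (sym (e fi))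
        (trans (blank-run t (point i) o a (point-blank (λ v f → proj₁ (Fresh-upd {i = i} z<s f))))
            (cong just (h refl)))
  tile (suc f) odd {pos} Y@(_ ∷ _ ∷ _ ∷ Y') le d h eq | pairS {i} {j} d'
    with fresh? n pos i | fresh? n (upd pos i (3 + length Y')) j
  ... | no nf | _ = ⊥-elim (wasteful f odd Y 1 2 3 (s≤s (m≤n⇒m≤1+n (bit≤1 odd))) (≤ᵇ⇒≤ _ _ _) le ≤-refl
        (≤-trans (≤-reflexive (sym (count-stale n pos i z<s nf))) (count-upd n _ j z<s)) d' eq)
  ... | yes _ | no nf = ⊥-elim (wasteful f odd Y 1 2 3 (s≤s (m≤n⇒m≤1+n (bit≤1 odd))) (≤ᵇ⇒≤ _ _ _) le ≤-refl
        (≤-trans (count-upd n pos i z<s) (s≤s (≤-reflexive (sym (count-stale n _ j z<s nf))))) d' eq)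
  ... | yes fi | yes fj = pair fi fj (tile f odd Y' (≤-trans (m≤n+m _ 2) (s≤s⁻¹ le)) d' h
                            (pair-eq n pos i j (length Y') (bit odd) fi fj eq))

-- Necessity of the conditions on the slots

module _ (n : ℕ) where

  -- A skip by +in:k preserves only Weak.  Only the slot directly before the single block
  -- skips, and only its condition has to be derived from Strong.
  Strong : (ℕ → ℕ) → ℕ → List Prim → ℕ → Set
  Strong pos m Y x = ∃ λ i → pos i ≡ m ×
    (∀ b → Low m pos b → b i ≡ true → run Y x (mkState b false zeros) ≡ just true)

  Weak : (ℕ → ℕ) → ℕ → List Prim → ℕ → Set
  Weak pos m Y x = ∃ λ i → pos i ≡ m × ∃ λ a → run Y x (mkState (point i) false a) ≡ just true

  -- A skip arrives at `x = 1`, where only the weak form may be known. An admissible target there is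
  -- the slot of the single block, and behind that block `odd` is false.
  Entry : Bool → (ℕ → ℕ) → ℕ → List Prim → ℕ → Set
  Entry odd pos m Y x = Weak pos m Y x × (odd ≡ true → 2 ≤ x → Strong pos m Y x)

  Entries : Bool → (pos dem : ℕ → ℕ) → List Prim → Set
  Entries odd pos dem Y = ∀ x → x < length Y → 0 < dem (length Y ∸ x) → Entry odd pos (dem (length Y ∸ x)) Y x

  Low-point : ∀ {pos m i} → pos i ≡ m → Low m pos (point i)
  Low-point {i = i} e k lt = point-other {i} {k} λ { refl → <⇒≢ lt (sym e) }

  strong⇒weak : ∀ {pos m Y} {x} → Strong pos m Y x → Weak pos m Y x
  strong⇒weak {pos} (i , e , h) = i , e , zeros , h (point i) (Low-point {pos} e) (≡ᵇ-refl i)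

  module _ {pos : ℕ → ℕ} {i r : ℕ} (u : pos i ≡ 0) where

    read-other : ∀ {k} → 0 < pos k → upd pos i r k ≡ pos k
    read-other lt = upd-other pos r λ { refl → <⇒≢ lt (sym u) }

    strong-upd : ∀ {m Y x} → 0 < m → Strong pos m Y x → Strong (upd pos i r) m Y x
    strong-upd lt (j , refl , h) = j , read-other lt ,
      λ b low → h b (λ k l → low k (subst (pos j <_) (sym (read-other (≤-<-trans z≤n l))) l))

    weak-upd : ∀ {m Y x} → 0 < m → Weak pos m Y x → Weak (upd pos i r) m Y x
    weak-upd lt (j , refl , h) = j , read-other lt , h

    entry-upd : ∀ {odd m Y x} → 0 < m → Entry odd pos m Y x → Entry odd (upd pos i r) m Y x
    entry-upd {Y = Y} {x} lt (w , s) = weak-upd {Y = Y} {x} lt w , λ e l → strong-upd {Y = Y} {x} lt (s e l)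

  -- A maximum is attained by the old demand or by the new one, so the witness of that one serves
  -- for both.
  entry-demand : ∀ {odd pos} dem Y x m → x < length Y → Entry odd pos m Y x → Entries odd pos dem Y →
                 Entries odd pos (demand dem (length Y ∸ x) m) Y
  entry-demand {odd} {pos} dem Y x m x<Y e es y y<Y lt with (length Y ∸ y) ≟ (length Y ∸ x)
  ... | no ne rewrite upd-other dem (dem (length Y ∸ x) ⊔ m) ne = es y y<Y lt
  ... | yes eq with refl ← ∸-cancelˡ-≡ (<⇒≤ y<Y) (<⇒≤ x<Y) eq
      rewrite upd-same dem (length Y ∸ y) (dem (length Y ∸ y) ⊔ m)
      with ⊔-sel (dem (length Y ∸ y)) m
  ...   | inj₁ p rewrite p = es y y<Y lt
  ...   | inj₂ p rewrite p = e

  Blank-point : ∀ {pos i} → 0 < pos i → Blank n pos (point i)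
  Blank-point {i = i} lt v f = point-other {i} {v} λ { refl → <⇒≢ lt (sym (Fresh.unread f)) }

  two : ℕ → ℕ → ℕ → Bool
  two i k j = (j ≡ᵇ i) ∨ (j ≡ᵇ k)

  two-other : ∀ i k j → j ≢ i → j ≢ k → two i k j ≡ false
  two-other i k j p q rewrite ≢⇒≡ᵇ p | ≢⇒≡ᵇ q = refl

  module Slot {pos dem : ℕ → ℕ} {m i : ℕ} {z : Prim} {Y : List Prim} (m>0 : 0 < m) (pi : pos i ≡ m) where

    blank : Blank n pos (point i)
    blank = Blank-point {pos} (subst (0 <_) (sym pi) m>0)

    no₀ : ∀ {odd} → Tiled n odd pos Y → ∀ {b a} → Blank n pos b → run Y 0 (mkState b false a) ≢ just true
    no₀ t bl e with () ← trans (sym e) (blank-run n t _ _ _ bl)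

    noIf : Tiled n false pos Y → ∀ c {a} →
        (if c then run Y 0 (mkState (point i) false a) else run Y 1 (mkState (point i) false a)) ≢ just true
    noIf t true  e = no₀ t blank e
    noIf t false e = blank-run₁ n t _ _ blank e

    noIf′ : Tiled n false pos Y → ∀ c {a} →
        (if c then run Y 1 (mkState (point i) false a) else run Y 0 (mkState (point i) false a)) ≢ just true
    noIf′ t true  e = blank-run₁ n t _ _ blank e
    noIf′ t false e = no₀ t blank e

    -- The witness has its 1 at a variable already read, so it looks blank to `Y`. An instruction
    -- that leaves `out` at 0 and falls through or skips one instruction thus never yields output 1.
    even : Tiled n false pos Y → ∀ {a} → run (z ∷ Y) 0 (mkState (point i) false a) ≡ just true →
           Entries false pos dem Y → ∃ λ dem' → SlotOk n pos dem m (length Y) z dem' × Entries false pos dem' Y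
    even = go z
      where
      go : ∀ z → Tiled n false pos Y → ∀ {a} → run (z ∷ Y) 0 (mkState (point i) false a) ≡ just true →
           Entries false pos dem Y → ∃ λ dem' → SlotOk n pos dem m (length Y) z dem' × Entries false pos dem' Y
      go (plain (outSet true))    t e es = dem , set , es
      go (ptest (outSet true))    t e es = dem , +set , es
      go (ntest (outSet true))    t e es = dem , -set (run-short Y 1 _ e) , es
      go (jump (suc l))           t e es = _ , link (run-short Y l _ e) ,
        entry-demand dem Y l m (run-short Y l _ e) ((i , pi , _ , e) , λ ()) es
      go (plain (inGet k))        t e es = ⊥-elim (no₀ t blank e)
      go (plain (outSet false))   t e es = ⊥-elim (no₀ t blank e)
      go (plain (auxGet k))       t e es = ⊥-elim (no₀ t blank e)
      go (plain (auxSet k b))     t e es = ⊥-elim (no₀ t blank e)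
      go (ptest (inGet k))        t e es = ⊥-elim (noIf t (point i k) e)
      go (ptest (outSet false))   t e es = ⊥-elim (noIf t false e)
      go (ptest (auxGet k)) t {a} e es = ⊥-elim (noIf t (a k) e)
      go (ptest (auxSet k b))     t e es = ⊥-elim (noIf t b e)
      go (ntest (inGet k))        t e es = ⊥-elim (noIf′ t (point i k) e)
      go (ntest (outSet false))   t e es = ⊥-elim (noIf′ t false e)
      go (ntest (auxGet k)) t {a} e es = ⊥-elim (noIf′ t (a k) e)
      go (ntest (auxSet k b))     t e es = ⊥-elim (noIf′ t b e)

    -- Two witnesses `p ≢ q` refute `-in:k`: at least one of them replies 0 and falls through onto
    -- the path. Auxiliary registers at 0 fix the replies of `aux:k.get`.
    odd : Tiled n true pos Y →
        (∀ b → Low m pos b → b i ≡ true → run (z ∷ Y) 0 (mkState b false zeros) ≡ just true) →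
          ∀ {p q} → p ≢ q → 0 < pos p → 0 < pos q →
          run (z ∷ Y) 0 (mkState (point p) false zeros) ≡ just true →
          run (z ∷ Y) 0 (mkState (point q) false zeros) ≡ just true →
          Entries true pos dem Y → ∃ λ dem' → SlotOk n pos dem m (length Y) z dem' × Entries true pos dem' Y
    odd t H {p} {q} p≢q p>0 q>0 ep eq es = go z H ep eq
      where
      E : ∀ z → (∀ b → Low m pos b → b i ≡ true → run (z ∷ Y) 0 (mkState b false zeros) ≡ just true) →
          run (z ∷ Y) 0 (mkState (point i) false zeros) ≡ just true
      E z H = H (point i) (Low-point {pos} pi) (≡ᵇ-refl i)
      skips : ∀ a → run Y 1 (mkState (point i) false a) ≡ just true → Entries true pos
          (demand dem (length Y ∸ 1) m) Y
      skips a e = entry-demand dem Y 1 m (run-short Y 1 _ e) ((i , pi , a , e) , λ { _ (s≤s ()) }) es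
      go : ∀ z → (∀ b → Low m pos b → b i ≡ true → run (z ∷ Y) 0 (mkState b false zeros) ≡ just true) →
           run (z ∷ Y) 0 (mkState (point p) false zeros) ≡ just true →
           run (z ∷ Y) 0 (mkState (point q) false zeros) ≡ just true →
           ∃ λ dem' → SlotOk n pos dem m (length Y) z dem' × Entries true pos dem' Y
      go (plain (outSet true))    H _ _ = dem , set , es
      go (ptest (outSet true))    H _ _ = dem , +set , es
      go (ntest (outSet true)) H e _ = dem , -set (run-short Y 1 _ e) , es
      go z@(jump (suc l)) H e _ = _ , link (run-short Y l _ e) ,
        entry-demand dem Y l m (run-short Y l _ e)
            (strong⇒weak {Y = Y} {x = l} (i , pi , H) , λ _ _ → i , pi , H) es
      go z@(ptest (outSet false)) H _ _ = _ , skip +out0 (run-short Y 1 _ (E z H)) , skips _ (E z H)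
      go z@(ptest (auxGet k))     H _ _ = _ , skip +aux (run-short Y 1 _ (E z H)) , skips _ (E z H)
      go z@(ptest (auxSet k false)) H _ _ = _ , skip +aux0 (run-short Y 1 _ (E z H)) , skips _ (E z H)
      go z@(ntest (auxSet k true)) H _ _ = _ , skip -aux1 (run-short Y 1 _ (E z H)) , skips _ (E z H)
      go z@(ptest (inGet k)) H _ _ with point i k | E z H
      ... | true  | e = ⊥-elim (no₀ t blank e)
      ... | false | e = _ , skipIn (run-short Y 1 _ e) known , skips _ e
        where
        -- If `k` is neither unread nor read before block `m`, then 1s at both `i` and `k` are
        -- compatible with leaving the path at `m`. The test `+in:k` then falls through to `Y`,
        -- which sees a blank input and ends with output 0.
        bad : (¬ Fresh n pos k) → ¬ m < pos k → ⊥
        bad nf nl = no₀ t bl (trans (sym (if-true hit))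
                              (H (two i k) low (cong (_∨ (i ≡ᵇ k)) (≡ᵇ-refl i))))
          where
          hit : two i k k ≡ true
          hit = trans (cong ((k ≡ᵇ i) ∨_) (≡ᵇ-refl k)) (∨-zeroʳ _)
          low : Low m pos (two i k)
          low j lt = two-other i k j (λ { refl → <⇒≢ lt (sym pi) }) (λ { refl → nl lt })
          bl : Blank n pos (two i k)
          bl v f = two-other i k v (λ { refl → <⇒≢ m>0 (trans (sym (Fresh.unread f)) pi) }) (λ { refl → nf f })
        known : (pos k ≡ 0 × k ≤ n) ⊎ m < pos k
        known with m <? pos k
        ... | yes lt = inj₂ lt
        ... | no nl with fresh? n pos k
        ...   | yes f = inj₁ (Fresh.unread f , Fresh.high f)
        ...   | no nf = ⊥-elim (bad nf nl)
      go (plain (inGet k))        H e _ = ⊥-elim (no₀ t (Blank-point p>0) e)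
      go (plain (outSet false))   H e _ = ⊥-elim (no₀ t (Blank-point p>0) e)
      go (plain (auxGet k))       H e _ = ⊥-elim (no₀ t (Blank-point p>0) e)
      go (plain (auxSet k b))     H e _ = ⊥-elim (no₀ t (Blank-point p>0) e)
      go (ptest (auxSet k true))  H e _ = ⊥-elim (no₀ t (Blank-point p>0) e)
      go (ntest (outSet false))   H e _ = ⊥-elim (no₀ t (Blank-point p>0) e)
      go (ntest (auxGet k))       H e _ = ⊥-elim (no₀ t (Blank-point p>0) e)
      go (ntest (auxSet k false)) H e _ = ⊥-elim (no₀ t (Blank-point p>0) e)
      go (ntest (inGet k))        H e₁ e₂ with k ≟ p
      ... | no ne = ⊥-elim (no₀ t (Blank-point p>0)
                      (trans (sym (if-false (point-other {p} {k} (ne ∘ sym)))) e₁))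
      ... | yes refl = ⊥-elim (no₀ t (Blank-point q>0)
                      (trans (sym (if-false (point-other {q} {p} (p≢q ∘ sym)))) e₂))

module _ (n : ℕ) where

  -- `Low 0 pos` says that every variable read so far is 0, that is, that the run is still on the
  -- path. There `out` and the auxiliary registers keep their initial 0.
  Meets : (ℕ → ℕ) → List Prim → Set
  Meets pos Y = ∀ b v → Low 0 pos b → 1 ≤ v → v ≤ n → b v ≡ true → run Y 0 (mkState b false zeros) ≡ just true

  Above : (ℕ → ℕ) → List Prim → Set
  Above pos Y = ∀ k → 0 < pos k → length Y < pos k

  no-entry : ∀ {d} → (0 < d → ⊥) → d ≡ 0
  no-entry {zero}  h = refl
  no-entry {suc d} h = ⊥-elim (h z<s)

  above-upd : ∀ {pos i r Y Y'} → length Y < r → length Y ≤ length Y' → Above pos Y' → Above (upd pos i r) Y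
  above-upd {pos} {i} {r} lt le ab k k>0 with k ≟ i
  ... | yes refl = subst (_ <_) (sym (upd-same pos i r)) lt
  ... | no ne    = subst (_ <_) (sym (upd-other pos r ne))
        (≤-<-trans le (ab k (subst (0 <_) (upd-other pos r ne) k>0)))

  low-back : ∀ {pos i r m b} → pos i ≡ 0 → Low m (upd pos i r) b → Low m pos b
  low-back {pos} {i} {r} u low k lt = low k
      (subst (_ <_) (sym (read-other n {pos} {i} {r} u (≤-<-trans z≤n lt))) lt)

  low-raise : ∀ {pos r b} → (∀ k → 0 < pos k → r < pos k) → Low r pos b → Low 0 pos b
  low-raise ab low k lt = low k (ab k lt)

  -- A demand brings a witness whose only 1 is at a variable already read; started at a block, it
  -- follows the path and outputs 0.
  start-free : ∀ {odd pos dem Y} → Tiled n odd pos Y → Entries n odd pos dem Y → 0 < length Y → dem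
      (length Y) ≡ 0
  start-free {pos = pos} {dem} {Y} t es Y>0 = no-entry λ d>0 → clash d>0 (es 0 Y>0 d>0)
    where
    clash : 0 < dem (length Y) → Entry n _ pos (dem (length Y)) Y 0 → ⊥
    clash d>0 ((i , e , a , h) , _)
      with () ← trans (sym h) (blank-run n t (point i) false a (Blank-point n {pos} (subst (0 <_) (sym e) d>0)))

  complete : ∀ {odd pos dem} Y → Tiled n odd pos Y → Meets pos Y → Entries n odd pos dem Y → Above pos Y →
      Acc n odd pos dem Y
  complete {dem = dem} Y stop M es ab = stop (start-free {dem = dem} stop es z<s)
  complete {odd} {pos} {dem} (ntest (inGet i) ∷ ptest (inGet j) ∷ z ∷ Y) t@(pair fi fj t') M es ab =
    pair (Fresh.high fi) (Fresh.unread fi) (start-free {dem = dem} t es z<s) (Fresh.high fj)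
        (Fresh.unread fj) middle
      (proj₁ (proj₂ slot)) (complete Y t' M' (proj₂ (proj₂ slot)) ab₂)
    where
    W = ntest (inGet i) ∷ ptest (inGet j) ∷ z ∷ Y
    r = 3 + length Y
    pos₁ = upd pos i r
    pos₂ = upd pos₁ j r
    d = dem (1 + length Y)
    m = d ⊔ r
    ui : pos i ≡ 0
    ui = Fresh.unread fi
    uj : pos₁ j ≡ 0
    uj = Fresh.unread fj
    i≢j : i ≢ j
    i≢j = proj₁ (Fresh-upd {r = r} z<s fj) ∘ sym
    pi : pos₂ i ≡ r
    pi = trans (upd-other pos₁ r i≢j) (upd-same pos i r)
    pj : pos₂ j ≡ r
    pj = upd-same pos₁ j r
    middle : dem (2 + length Y) ≡ 0
    bl : ∀ k {e} → pos k ≡ e → 0 < e → Blank n pos (point k)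
    bl k e lt = Blank-point n {pos} (subst (0 <_) (sym e) lt)
    middle = no-entry λ d>0 → clash d>0 (es 1 (s≤s (s≤s z≤n)) d>0)
      where
      clash : 0 < dem (2 + length Y) → Entry n odd pos (dem (2 + length Y)) W 1 → ⊥
      clash d>0 ((k , e , a , h) , _)
        with () ← trans (sym h) (trans (if-false (bl k e d>0 j (proj₂ (Fresh-upd {r = r} z<s fj))))
                    (blank-run n t' (point k) false a
                        (Blank-upd n {pos₁} {j} {b = point k} z<s
                            (Blank-upd n {pos} {i} {b = point k} z<s (bl k e d>0)))))
    low₀ : ∀ {b} → Low r pos₂ b → Low 0 pos b
    low₀ low = low-raise {pos} {r} ab (low-back {pos} {i} {r} ui (low-back {pos₁} {j} {r} uj low))
    first : ∀ b → Low r pos₂ b → b i ≡ true → run (z ∷ Y) 0 (mkState b false zeros) ≡ just true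
    first b low bi = trans (sym (if-true bi)) (M b i (low₀ low) (Fresh.low fi) (Fresh.high fi) bi)
    second : ∀ b → Low r pos₂ b → b i ≡ false → b j ≡ true → run (z ∷ Y) 0 (mkState b false zeros) ≡ just true
    second b low bi bj = trans (sym (trans (if-false bi) (if-true bj)))
        (M b j (low₀ low) (Fresh.low fj) (Fresh.high fj) bj)
    es' : Entries n odd pos₂ dem Y
    -- Seen from `W` such an entry is at `3 + x ≥ 2`, so it carries the strong form even if `x` is
    -- 1.
    es' x x<Y d>0 with es (3 + x) (s≤s (s≤s (s≤s x<Y))) d>0
    ... | w , s = entry-upd n {pos₁} {j} {r} uj {odd} {Y = Y} {x} d>0
          (entry-upd n {pos} {i} {r} ui {odd} {Y = Y} {x} d>0 (w , λ o _ → s o (s≤s (s≤s z≤n))))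
    m>0 : 0 < m
    m>0 = <-≤-trans z<s (m≤n⊔m d r)
    weak : Weak n pos₂ m (z ∷ Y) 0
    -- The demand is attained either by the test of `i` in this block or by an earlier jump to the
    -- slot.
    weak with d ≤? r
    ... | yes le rewrite m≤n⇒m⊔n≡n le = strong⇒weak n {pos₂} {r} {z ∷ Y} {0} (i , pi , first)
    ... | no nle rewrite m≥n⇒m⊔n≡m (≰⇒≥ nle) =
      weak-upd n {pos₁} {j} {r} uj {d} {z ∷ Y} {0} d>0
          (weak-upd n {pos} {i} {r} ui {d} {z ∷ Y} {0} d>0 (proj₁ (es 2 (s≤s (s≤s (s≤s z≤n))) d>0)))
      where
      d>0 : 0 < d
      d>0 = ≤-<-trans z≤n (≰⇒> nle)
    strong : odd ≡ true → Strong n pos₂ m (z ∷ Y) 0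
    strong o with d ≤? r
    ... | yes le rewrite m≤n⇒m⊔n≡n le = i , pi , first
    ... | no nle rewrite m≥n⇒m⊔n≡m (≰⇒≥ nle) =
      strong-upd n {pos₁} {j} {r} uj {d} {z ∷ Y} {0} d>0
          (strong-upd n {pos} {i} {r} ui {d} {z ∷ Y} {0} d>0 (proj₂ (es 2 (s≤s (s≤s (s≤s z≤n))) d>0) o ≤-refl))
      where
      d>0 : 0 < d
      d>0 = ≤-<-trans z≤n (≰⇒> nle)
    slot : ∃ λ dem' → SlotOk n pos₂ dem m (length Y) z dem' × Entries n odd pos₂ dem' Y
    slot = pick odd refl
      where
      pick : ∀ o → odd ≡ o → ∃ λ dem' → SlotOk n pos₂ dem m (length Y) z dem' × Entries n odd pos₂ dem' Y
      pick false refl with weak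
      ... | k , e , a , h = Slot.even n {pos₂} {dem} {m} {k} {z} {Y} m>0 e t' h es'
      pick true refl with strong refl
      ... | k , e , h = Slot.odd n {pos₂} {dem} {m} {k} {z} {Y} m>0 e t' h i≢j
              (subst (0 <_) (sym pi) z<s) (subst (0 <_) (sym pj) z<s)
              (first (point i) (Low-point n {pos₂} pi) (≡ᵇ-refl i))
              (second (point j) (Low-point n {pos₂} pj) (point-other (i≢j ∘ sym)) (≡ᵇ-refl j)) es'
    M' : Meets pos₂ Y
    M' b v low v≥1 v≤n bv = trans
        (sym (trans (if-false (low i (subst (0 <_) (sym pi) z<s)))
            (if-false (low j (subst (0 <_) (sym pj) z<s)))))
      (M b v (low-back {pos} {i} {r} ui (low-back {pos₁} {j} {r} uj low)) v≥1 v≤n bv)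
    ab₂ : Above pos₂ Y
    ab₂ = above-upd {pos₁} {j} {r} {Y} {Y} (m≤n+m _ 2) ≤-refl
        (above-upd {pos} {i} {r} {Y} {W} (m≤n+m _ 2) (m≤n+m _ 3) ab)
  complete {pos = pos} {dem} (ptest (inGet i) ∷ z ∷ Y) t@(single fi t') M es ab =
    single (Fresh.high fi) ui (start-free {dem = dem} t es z<s) (proj₁ (proj₂ slot))
        (complete Y t' M' (proj₂ (proj₂ slot)) ab₁)
    where
    W = ptest (inGet i) ∷ z ∷ Y
    r = 2 + length Y
    pos₁ = upd pos i r
    d = dem (1 + length Y)
    m = d ⊔ r
    ui : pos i ≡ 0
    ui = Fresh.unread fi
    pi : pos₁ i ≡ r
    pi = upd-same pos i r
    first : ∀ b → Low r pos₁ b → b i ≡ true → run (z ∷ Y) 0 (mkState b false zeros) ≡ just true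
    first b low bi = trans (sym (if-true bi))
      (M b i (low-raise {pos} {r} ab (low-back {pos} {i} {r} ui low)) (Fresh.low fi) (Fresh.high fi) bi)
    es' : Entries n false pos₁ dem Y
    es' x x<Y d>0 with es (2 + x) (s≤s (s≤s x<Y)) d>0
    ... | w , s = entry-upd n {pos} {i} {r} ui {false} {Y = Y} {x} d>0 (w , λ ())
    m>0 : 0 < m
    m>0 = <-≤-trans z<s (m≤n⊔m d r)
    weak : Weak n pos₁ m (z ∷ Y) 0
    weak with d ≤? r
    ... | yes le rewrite m≤n⇒m⊔n≡n le = strong⇒weak n {pos₁} {r} {z ∷ Y} {0} (i , pi , first)
    ... | no nle rewrite m≥n⇒m⊔n≡m (≰⇒≥ nle) =
      weak-upd n {pos} {i} {r} ui {d} {z ∷ Y} {0} d>0 (proj₁ (es 1 (s≤s (s≤s z≤n)) d>0))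
      where
      d>0 : 0 < d
      d>0 = ≤-<-trans z≤n (≰⇒> nle)
    slot : ∃ λ dem' → SlotOk n pos₁ dem m (length Y) z dem' × Entries n false pos₁ dem' Y
    slot with weak
    ... | k , e , a , h = Slot.even n {pos₁} {dem} {m} {k} {z} {Y} m>0 e t' h es'
    M' : Meets pos₁ Y
    M' b v low v≥1 v≤n bv = trans (sym (if-false (low i (subst (0 <_) (sym pi) z<s))))
      (M b v (low-back {pos} {i} {r} ui low) v≥1 v≤n bv)
    ab₁ : Above pos₁ Y
    ab₁ = above-upd {pos} {i} {r} {Y} {W} (m≤n+m _ 1) (m≤n+m _ 2) ab

-- Correctness of the criterion

tstnz-zero : ∀ {n} (b : Vec Bool n) → (∀ i → lookup b i ≡ false) → tstnz b ≡ false
tstnz-zero []ᵥ       h = refl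
tstnz-zero (x ∷ᵥ b) h rewrite h fzero = tstnz-zero b (h ∘ fsuc)

tstnz-one : ∀ {n} (b : Vec Bool n) i → lookup b i ≡ true → tstnz b ≡ true
tstnz-one (x ∷ᵥ b) fzero    refl = refl
tstnz-one (x ∷ᵥ b) (fsuc i) h    = trans (cong (x ∨_) (tstnz-one b i h)) (∨-zeroʳ x)

tstnz-cases : ∀ {n} (b : Vec Bool n) → (∀ i → lookup b i ≡ false) ⊎ (∃ λ i → lookup b i ≡ true)
tstnz-cases []ᵥ           = inj₁ λ ()
tstnz-cases (true ∷ᵥ b)  = inj₂ (fzero , refl)
tstnz-cases (false ∷ᵥ b) with tstnz-cases b
... | inj₁ h       = inj₁ λ { fzero → refl ; (fsuc i) → h i }
... | inj₂ (i , h) = inj₂ (fsuc i , h)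

unread : ℕ → ℕ
unread _ = 0

isOdd : ℕ → Bool
isOdd zero          = false
isOdd (suc zero)    = true
isOdd (suc (suc n)) = isOdd n

half : ∀ m {k} → k ≡ 6 + m → k / 2 ≡ 3 + m / 2
half m refl = +-distrib-/ 6 m (m%n<n m 2)

L-suc-suc : ∀ n → L (2 + n) ≡ 3 + L n
L-suc-suc n with n % 2 ≡ᵇ 0
... | true  = cong (_+ 1) (half (3 * n) (lem₁ n))
  where
  lem₁ : ∀ n → 3 * (2 + n) ≡ 6 + 3 * n
  lem₁ = solve-∀
... | false = half (3 * (n + 1)) (lem₂ n)
  where
  lem₂ : ∀ n → 3 * (2 + n + 1) ≡ 6 + 3 * (n + 1)
  lem₂ = solve-∀

-- In steps of two, `L` grows by 3 and both sides by 6, so the two cases of the definition of `L`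
-- need no separate treatment.
L-tight : ∀ n → 2 * L n ≡ 3 * n + 2 + bit (isOdd n)
L-tight zero          = refl
L-tight (suc zero)    = refl
L-tight (suc (suc n)) = trans (cong (2 *_) (L-suc-suc n))
    (trans (lem₁ (L n)) (trans (cong (λ c → 6 + c) (L-tight n)) (lem₂ n (bit (isOdd n)))))
  where
  lem₁ : ∀ l → 2 * (3 + l) ≡ 6 + 2 * l
  lem₁ = solve-∀
  lem₂ : ∀ n o → 6 + (3 * n + 2 + o) ≡ 3 * (2 + n) + 2 + o
  lem₂ = solve-∀

maxAux : List Prim → ℕ
maxAux []      = 0
maxAux (x ∷ X) = auxIndex x ⊔ maxAux X

maxAux-bound : ∀ {K} X → maxAux X ≤ K → All (λ z → auxIndex z ≤ K) X
maxAux-bound []      le = []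
maxAux-bound (x ∷ X) le = ≤-trans (m≤m⊔n _ _) le ∷ maxAux-bound X (≤-trans (m≤n⊔m (auxIndex x) _) le)

module _ (n : ℕ) (X : List Prim) (valid : IS X) (len : length X ≡ L n) where

  tight : 2 * length X ≡ 3 * count n unread + 2 + bit (isOdd n)
  tight = trans (cong (2 *_) len)
      (trans (L-tight n) (cong (λ c → 3 * c + 2 + bit (isOdd n)) (sym (count-init n))))

  Acc⇒Computes : Acc n (isOdd n) unread unread X → Computes X (tstnz {n})
  Acc⇒Computes acc = K , λ b inp aux hb ha → run⇒exec X _ (value b inp aux hb ha)
    where
    K = maxAux X
    S : Sound n K (isOdd n) unread unread X
    S = sound n K X acc valid (maxAux-bound X ≤-refl) tight (λ _ ())
    value : ∀ (b : Vec Bool n) inp aux → (∀ i → inp (suc (toℕ i)) ≡ lookup b i) →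
            (∀ i → 1 ≤ i → i ≤ K → aux i ≡ false) → run X 0 (mkState inp false aux) ≡ just (tstnz b)
    value b inp aux hb ha with tstnz-cases b
    ... | inj₁ z = trans (Sound.blank S _ blank) (cong just (sym (tstnz-zero b z)))
      where
      blank : ∀ v → Fresh n unread v → inp v ≡ false
      blank (suc v) (fresh _ v<n _) = trans (cong (inp ∘ suc) (sym (toℕ-fromℕ< v<n)))
          (trans (hb (fromℕ< v<n)) (z _))
    ... | inj₂ (i , e) = trans
          (Sound.live S _ (suc (toℕ i)) (fresh (s≤s z≤n) (toℕ<n i) refl) (trans (hb i) e) (inj₂ (ha , λ _ ())))
                           (cong just (sym (tstnz-one b i e)))

  Computes⇒Acc : Computes X (tstnz {n}) → Acc n (isOdd n) unread unread X
  Computes⇒Acc (k , C) = complete n X (tile n _ (isOdd n) X ≤-refl d (λ _ → refl) tight) meets (λ _ _ ())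
      (λ _ ())
    where
    bits : (ℕ → Bool) → Vec Bool n
    bits b = tabulate (λ i → b (suc (toℕ i)))
    outcome : ∀ b → run X 0 (mkState b false zeros) ≡ just (tstnz (bits b))
    -- All auxiliary registers at 0 meet the initial condition whatever `k` is.
    outcome b with C (bits b) b zeros (λ i → sym (lookup∘tabulate _ i)) (λ _ _ _ → refl)
    ... | s , e , o = trans (exec⇒run X _ e) (cong just o)
    meets : Meets n unread X
    meets b (suc v) _ v≥1 v≤n bv = trans (outcome b) (cong just (tstnz-one (bits b) (fromℕ< v≤n)
      (trans (lookup∘tabulate _ (fromℕ< v≤n)) (trans (cong (b ∘ suc) (toℕ-fromℕ< v≤n)) bv))))
    d : Disc n unread X false zeros
    d = disc (trans (outcome zeros) (cong just (tstnz-zero (bits zeros) (lookup∘tabulate _))))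
          (λ v f → meets (point v) v (λ _ ()) (Fresh.low f) (Fresh.high f) (≡ᵇ-refl v))

-- Random access machine programs as decision trees

-- The ten named registers form a vector, so that accesses to them reduce by computation. The heap
-- holds the registers from 10 on, shifted by 10.
record Memory : Set where
  constructor memory
  field
    scratch : Vec ℤ 10
    heap    : ℕ → ℤ
    pending : List ℤ

getV : ∀ {k} → Vec ℤ k → (ℕ → ℤ) → ℕ → ℤ
getV []ᵥ       h i       = h i
getV (x ∷ᵥ v) h zero    = x
getV (x ∷ᵥ v) h (suc i) = getV v h i

setV : ∀ {k} → Vec ℤ k → ℕ → ℤ → Vec ℤ k
setV []ᵥ       i       z = []ᵥ
setV (x ∷ᵥ v) zero    z = z ∷ᵥ v
setV (x ∷ᵥ v) (suc i) z = x ∷ᵥ setV v i z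

setH : ℕ → (ℕ → ℤ) → ℕ → ℤ → ℕ → ℤ
setH zero    h i       z = updZ h i z
setH (suc k) h zero    z = h
setH (suc k) h (suc i) z = setH k h i z

get-set : ∀ {k} (v : Vec ℤ k) h i z j → getV (setV v i z) (setH k h i z) j ≡ (if j ≡ᵇ i then z else getV v h j)
get-set []ᵥ       h i       z j       = refl
get-set (x ∷ᵥ v) h zero    z zero    = refl
get-set (x ∷ᵥ v) h zero    z (suc j) = refl
get-set (x ∷ᵥ v) h (suc i) z zero    = refl
get-set (x ∷ᵥ v) h (suc i) z (suc j) = get-set v h i z j

get : Memory → ℕ → ℤ
get (memory v h _) = getV v h

store : ℕ → ℤ → Memory → Memory
store i z (memory v h inp) = memory (setV v i z) (setH 10 h i z) inp

indirect : ℤ → (ℕ → Memory) → Maybe Memory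
indirect (+ a)    f = just (f a)
indirect -[1+ _ ] f = nothing

readInto : ℕ → List ℤ → Memory → Maybe Memory
readInto i []        s = nothing
readInto i (x ∷ inp) s = just (store i x (record s { pending = inp }))

exec₁ : RInstr → Memory → Maybe Memory
exec₁ (LOAD c i)   s = just (store i c s)
exec₁ (ADD i j k)  s = just (store i (get s j ℤ.+ get s k) s)
exec₁ (SUB i j k)  s = just (store i (get s j ℤ.- get s k) s)
exec₁ (ILOAD i j)  s = indirect (get s j) λ a → store i (get s a) s
exec₁ (ISTORE i j) s = indirect (get s i) λ a → store a (get s j) s
exec₁ (READ i)     s = readInto i (Memory.pending s) s
exec₁ _            s = nothing

positive : ℤ → Bool
positive x = does (+ 0 ℤ.<? x)

-- Register 4 constantly holds 1, which makes the jump of goto unconditional.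
infixr 5 _▸_
data Tree : Set where
  _▸_    : RInstr → Tree → Tree
  branch : ℕ → Tree → Tree → Tree
  goto   : ℕ → Tree
  ans    : Bool → Tree

data Outcome : Set where
  halts : Bool → Outcome
  jumps : ℕ → Memory → Outcome
  fails : Outcome

eval : Tree → Memory → Outcome
eval (ι ▸ T)        s = maybe′ (eval T) fails (exec₁ ι s)
eval (branch j T U) s = if positive (get s j) then eval T s else eval U s
eval (goto a)       s = if positive (get s 4) then jumps a s else fails
eval (ans b)        s = halts b

-- The length of the compiled code and also a bound on its time, since a tree has no loops.
size : Tree → ℕ
size (ι ▸ T)        = suc (size T)
size (branch j T U) = suc (size U + size T)
size (goto a)       = 1
size (ans b)        = 3

compile : ℕ → Tree → RProgram
compile p (ι ▸ T)        = ι ∷ compile (suc p) T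
compile p (branch j T U) = JPOS (suc p + size U) j ∷ compile (suc p) U ++ compile (suc p + size U) T
compile p (goto a)       = JPOS a 4 ∷ []
compile p (ans b)        = LOAD (if b then + 1 else + 0) 7 ∷ PRINT 7 ∷ HALT ∷ []

length-compile : ∀ p T → length (compile p T) ≡ size T
length-compile p (ι ▸ T)        = cong suc (length-compile (suc p) T)
length-compile p (branch j T U) = cong suc (trans (length-++ (compile (suc p) U))
  (cong₂ _+_ (length-compile (suc p) U) (length-compile (suc p + size U) T)))
length-compile p (goto a)       = refl
length-compile p (ans b)        = refl

runR-mono : ∀ P t k c {o} → runR P t c ≡ just o → runR P (t + k) c ≡ just o
runR-mono P (suc t) k c eq with stepR P c
... | halted o = eq
... | next c'  = runR-mono P t k c' eq

runR-mono-≤ : ∀ P {t u} c {o} → t ≤ u → runR P t c ≡ just o → runR P u c ≡ just o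
runR-mono-≤ P {t} c le eq = subst (λ u → runR P u c ≡ just _) (m+[n∸m]≡n le) (runR-mono P t _ c eq)

record Located (P : RProgram) (p : ℕ) (Q : RProgram) : Set where
  constructor located
  field
    at : ∀ k {ι} → fetch Q k ≡ just ι → fetch P (p + k) ≡ just ι
open Located

located-head : ∀ {P p ι Q} → Located P p (ι ∷ Q) → fetch P p ≡ just ι
located-head {P} {p} l = trans (cong (fetch P) (sym (+-identityʳ p))) (at l 0 refl)

located-tail : ∀ {P p ι Q} → Located P p (ι ∷ Q) → Located P (suc p) Q
located-tail {P} {p} l = located λ k e → trans (cong (fetch P) (sym (+-suc p k))) (at l (suc k) e)

fetch-++ˡ : ∀ Q R k {ι} → fetch Q k ≡ just ι → fetch (Q ++ R) k ≡ just ι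
fetch-++ˡ (x ∷ Q) R zero    e = e
fetch-++ˡ (x ∷ Q) R (suc k) e = fetch-++ˡ Q R k e

fetch-++ʳ : ∀ Q R k → fetch (Q ++ R) (length Q + k) ≡ fetch R k
fetch-++ʳ []      R k = refl
fetch-++ʳ (x ∷ Q) R k = fetch-++ʳ Q R k

located-++ˡ : ∀ {P p} Q R → Located P p (Q ++ R) → Located P p Q
located-++ˡ Q R l = located λ k e → at l k (fetch-++ˡ Q R k e)

located-++ʳ : ∀ {P p} Q R → Located P p (Q ++ R) → Located P (p + length Q) R
located-++ʳ {P} {p} Q R l = located λ k e →
  trans (cong (fetch P) (+-assoc p (length Q) k)) (at l (length Q + k) (trans (fetch-++ʳ Q R k) e))

Match : (ℕ → ℤ) → Memory → Set
Match r s = ∀ i → r i ≡ get s i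

match-store : ∀ {r} s i {x y} → x ≡ y → Match r s → Match (updZ r i x) (store i y s)
match-store (memory v h inp) i {x} refl m j =
  trans (cong (λ z → if j ≡ᵇ i then x else z) (m j)) (sym (get-set v h i x j))

config : ℕ → (ℕ → ℤ) → Memory → Config
config p r s = mkConfig p r (Memory.pending s) []

exec₁-sound : ∀ ι p {r s s'} → Match r s → exec₁ ι s ≡ just s' →
              ∃ λ r' → exeR ι (config p r s) ≡ next (config (suc p) r' s') × Match r' s'
exec₁-sound (LOAD c i)   p {r} {s} m refl = _ , refl , match-store s i refl m
exec₁-sound (ADD i j k)  p {r} {s} m refl = _ , refl , match-store s i (cong₂ ℤ._+_ (m j) (m k)) m
exec₁-sound (SUB i j k)  p {r} {s} m refl = _ , refl , match-store s i (cong₂ ℤ._-_ (m j) (m k)) m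
exec₁-sound (ILOAD i j)  p {r} {s} m e with r j | get s j | m j
... | + a | + .a | refl with refl ← e = _ , refl , match-store s i (m a) m
exec₁-sound (ISTORE i j) p {r} {s} m e with r i | get s i | m i
... | + a | + .a | refl with refl ← e = _ , refl , match-store s a (m j) m
exec₁-sound (READ i)     p {r} {memory v h (x ∷ inp)} m refl = _ , refl , match-store (memory v h inp) i refl m

module _ (P : RProgram) where

  Finishes : Outcome → ℕ → List ℤ → Set
  Finishes (halts d)   t o = answer d ≡ o
  Finishes (jumps a s) t o = ∀ r → Match r s → runR P t (config a r s) ≡ just o
  Finishes fails       t o = ⊥

  step-next : ∀ {c c' ι} t → fetch P (pc c) ≡ just ι → exeR ι c ≡ next c' → runR P (suc t) c ≡ runR P t c'
  step-next t e₁ e₂ rewrite e₁ | e₂ = refl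

  simulate : ∀ T p {r s t o} → Located P p (compile p T) → Match r s → Finishes (eval T s) t o →
             runR P (size T + t) (config p r s) ≡ just o
  simulate (ι ▸ T) p {s = s} {t} l m f with exec₁ ι s in e
  ... | just s' with exec₁-sound ι p m e
  ...   | r' , e' , m' = trans (step-next (size T + t) (located-head {P} l) e')
        (simulate T (suc p) (located-tail {P} l) m' f)
  simulate (branch j T U) p {r} {s} {t} {o} l m f with positive (get s j) in e
  ... | true = trans (step-next _ (located-head {P} l) (if-true (trans (cong positive (m j)) e)))
                 (runR-mono-≤ P _ (+-monoˡ-≤ t (m≤n+m (size T) (size U)))
                   (simulate T q (subst (λ x → Located P (suc p + x) (compile q T)) (length-compile (suc p) U)
                     (located-++ʳ {P} (compile (suc p) U) (compile q T) (located-tail {P} l))) m f))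
    where
    q = suc p + size U
  ... | false = trans (step-next _ (located-head {P} l) (if-false (trans (cong positive (m j)) e)))
                 (runR-mono-≤ P _ (+-monoˡ-≤ t (m≤m+n (size U) (size T)))
                   (simulate U (suc p) (located-++ˡ {P} (compile (suc p) U) (compile q T)
                       (located-tail {P} l)) m f))
    where
    q = suc p + size U
  simulate (goto a) p {r} {s} {t} l m f with positive (get s 4) in e
  ... | true = trans (step-next _ (located-head {P} l) (if-true (trans (cong positive (m 4)) e))) (f r m)
  simulate (ans b) p {r} {s} {t} l m refl =
    trans (step-next _ (located-head {P} l) refl)
      (trans (step-next _ (located-head {P} (located-tail {P} l)) refl)
        (trans (stop-halt (located-head {P} (located-tail {P} (located-tail {P} l)))) (cong just (shape b))))
    where
    stop-halt : ∀ {c t} → fetch P (pc c) ≡ just HALT → runR P (suc t) c ≡ just (output c)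
    stop-halt e rewrite e = refl
    shape : ∀ b → (if b then + 1 else + 0) ∷ [] ≡ answer b
    shape true  = refl
    shape false = refl

  simulate-to : ∀ T p {r s t o e} → Located P p (compile p T) → Match r s → eval T s ≡ e → Finishes e t o →
                runR P (size T + t) (config p r s) ≡ just o
  simulate-to T p l m refl f = simulate T p l m f

-- The deciding program

-- Register 1 holds n, 2 the number of remaining instructions, 3 the parity of the number
-- of unread variables, 5 and 6 the current instruction, 9 the remaining length at the
-- block under consideration; 7 and 8 are temporary.  Case lists are indexed by the form
-- of the instruction.  In the final program lengthT is at address 4 and bodyT at 15.

reject : Tree
reject = ans false

loop : Tree
loop = goto 15

-- The form is counted down to 0, in bounded time because there are only 20 forms.
dispatch : List Tree → Tree
dispatch []       = reject
dispatch (T ∷ Ts) = branch 5 (SUB 5 5 4 ▸ dispatch Ts) T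

-- Only positivity can be tested, so `k ≤ n` is decided as `n - k + 1 > 0`.
freshT : Tree → Tree
freshT T = SUB 7 1 6 ▸ ADD 7 7 4 ▸ branch 7
  (ADD 7 6 6 ▸ LOAD (+ 10) 8 ▸ ADD 7 8 7 ▸ ILOAD 8 7 ▸ branch 8 reject (ISTORE 7 9 ▸ T)) reject

freeT : Tree → Tree
freeT T = ADD 7 2 2 ▸ LOAD (+ 11) 8 ▸ ADD 7 8 7 ▸ ILOAD 8 7 ▸ branch 8 reject T

-- Register 9 becomes the maximum of the block position and the demand on the slot. Register 0
-- always holds 0, so `ADD 9 0 8` is a copy.
raiseT : Tree → Tree
raiseT T = ADD 7 2 2 ▸ LOAD (+ 11) 8 ▸ ADD 7 8 7 ▸ ILOAD 8 7 ▸ SUB 7 8 9 ▸ branch 7 (ADD 9 0 8 ▸ T) T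

storeT : Tree
storeT = ADD 7 7 7 ▸ LOAD (+ 11) 8 ▸ ADD 7 8 7 ▸ ILOAD 8 7 ▸ SUB 8 9 8 ▸ branch 8 (ISTORE 7 9 ▸ loop) loop

linkT : Tree
linkT = branch 6 (SUB 7 2 6 ▸ ADD 7 7 4 ▸ branch 7 storeT reject) reject

-- A skip has the effect of the jump `#2`.
skipT : Tree
skipT = LOAD (+ 2) 6 ▸ linkT

checkT : Tree → Tree
checkT T = ADD 7 6 6 ▸ LOAD (+ 10) 8 ▸ ADD 7 8 7 ▸ ILOAD 8 7 ▸ branch 8
  (SUB 8 8 9 ▸ branch 8 T reject)
  (SUB 7 1 6 ▸ ADD 7 7 4 ▸ branch 7 T reject)

slotT : Tree
slotT = SUB 2 2 4 ▸ READ 5 ▸ READ 6 ▸ dispatch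
  (reject ∷ reject ∷ loop ∷ reject ∷ reject ∷ reject ∷
   checkT skipT ∷ skipT ∷ loop ∷ skipT ∷ skipT ∷ reject ∷
   reject ∷ reject ∷ (SUB 7 2 4 ▸ branch 7 loop reject) ∷ reject ∷ reject ∷ skipT ∷
   linkT ∷ reject ∷ [])

secondCases : List Tree
secondCases = reject ∷ reject ∷ reject ∷ reject ∷ reject ∷ reject ∷ freshT
    (freeT (SUB 2 2 4 ▸ raiseT slotT)) ∷ []

secondT : Tree
secondT = SUB 2 2 4 ▸ READ 5 ▸ READ 6 ▸ dispatch secondCases

pairT : Tree
pairT = LOAD (+ 2) 7 ▸ SUB 7 2 7 ▸ branch 7 (ADD 9 0 2 ▸ freshT (freeT secondT)) reject

clearT : Tree
clearT = LOAD (+ 0) 3 ▸ SUB 2 2 4 ▸ raiseT slotT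

singleT : Tree
singleT = branch 3 (SUB 7 2 4 ▸ branch 7
  (ADD 9 0 2 ▸ freshT (freeT clearT)) reject) reject

-- Register 13 = 11 + 2 * 1 holds the demand on the final `!`.
haltT : Tree
haltT = SUB 7 2 4 ▸ branch 7 reject (LOAD (+ 13) 7 ▸ ILOAD 8 7 ▸ branch 8 reject (ans true))

bodyCases : List Tree
bodyCases =
  reject ∷ reject ∷ reject ∷ reject ∷ reject ∷ reject ∷ singleT ∷ reject ∷ reject ∷ reject ∷ reject ∷ reject ∷
   pairT ∷ reject ∷ reject ∷ reject ∷ reject ∷ reject ∷ reject ∷ haltT ∷ []

bodyT : Tree
bodyT = branch 2 (READ 5 ▸ READ 6 ▸ dispatch bodyCases) reject

startT : Tree
startT = READ 1 ▸ LOAD (+ 1) 4 ▸ ADD 7 0 1 ▸ goto 4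

-- Without division, `L` is accumulated by `L (2 + n) ≡ 3 + L n` while `n` is counted down by two.
-- The rest 0 or 1 is the parity, and twice the rest plus 1 gives `L 0` = 1 and `L 1` = 3.
lengthT : Tree
lengthT = SUB 8 7 4 ▸ branch 8
  (SUB 7 8 4 ▸ LOAD (+ 3) 8 ▸ ADD 2 8 2 ▸ goto 4)
  (ADD 3 0 7 ▸ ADD 2 7 2 ▸ ADD 2 7 2 ▸ ADD 2 4 2 ▸ loop)

-- Correctness of the program fragments

positive-sub : ∀ {a b} → b < a → positive (+ a ℤ.- + b) ≡ true
positive-sub {a} {b} lt rewrite ℤₚ.m-n≡m⊖n a b | ℤₚ.⊖-≥ (<⇒≤ lt) with a ∸ b | m<n⇒0<n∸m lt
... | suc _ | _ = refl

nonpositive-sub : ∀ {a b} → a ≤ b → positive (+ a ℤ.- + b) ≡ false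
nonpositive-sub {a} {b} le rewrite ℤₚ.m-n≡m⊖n a b | ℤₚ.⊖-≤ le with b ∸ a
... | zero  = refl
... | suc _ = refl

sub-suc : ∀ a b → (+ a ℤ.- + b) ℤ.+ + 1 ≡ + suc a ℤ.- + b
sub-suc a b = trans (ℤₚ.+-assoc (+ a) (ℤ.- + b) (+ 1))
  (trans (cong (λ x → + a ℤ.+ x) (ℤₚ.+-comm (ℤ.- + b) (+ 1)))
    (trans (sym (ℤₚ.+-assoc (+ a) (+ 1) (ℤ.- + b))) (cong (λ x → + x ℤ.+ (ℤ.- + b)) (+-comm a 1))))

layout : ℕ → ℕ → ℕ → (t₅ t₆ t₇ t₈ t₉ : ℤ) → (ℕ → ℤ) → List ℤ → Memory
layout n l o t₅ t₆ t₇ t₈ t₉ h inp =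
  memory (+ 0 ∷ᵥ + n ∷ᵥ + l ∷ᵥ + o ∷ᵥ + 1 ∷ᵥ t₅ ∷ᵥ t₆ ∷ᵥ t₇ ∷ᵥ t₈ ∷ᵥ t₉ ∷ᵥ []ᵥ) h inp

-- Register 10 + 2k holds pos k and register 11 + 2a holds dem a.
record Tables (pos dem : ℕ → ℕ) (h : ℕ → ℤ) : Set where
  constructor tables
  field
    even : ∀ k → h (k + k) ≡ + pos k
    odd  : ∀ a → h (suc (a + a)) ≡ + dem a
open Tables

double-injective : ∀ {a b} → a + a ≡ b + b → a ≡ b
double-injective {zero}  {zero}  e = refl
double-injective {suc a} {suc b} e =
  cong suc (double-injective (suc-injective (trans (sym (+-suc a a)) (trans (suc-injective e) (+-suc b b)))))

double≢suc : ∀ a b → a + a ≢ suc (b + b)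
double≢suc (suc a) zero    e with () ← trans (sym (+-suc a a)) (suc-injective e)
double≢suc (suc a) (suc b) e =
  double≢suc a b (suc-injective (trans (sym (+-suc a a)) (trans (suc-injective e) (cong suc (+-suc b b)))))

mark : ∀ {pos dem h} i r → Tables pos dem h → Tables (upd pos i r) dem (updZ h (i + i) (+ r))
mark {pos} {dem} {h} i r t = tables ev od
  where
  ev : ∀ k → updZ h (i + i) (+ r) (k + k) ≡ + upd pos i r k
  ev k with k ≟ i
  ... | yes refl = trans (upd-same h (k + k) (+ r)) (cong +_ (sym (upd-same pos k r)))
  ... | no ne    = trans (upd-other h (+ r) (ne ∘ double-injective))
        (trans (even t k) (cong +_ (sym (upd-other pos r ne))))
  od : ∀ a → updZ h (i + i) (+ r) (suc (a + a)) ≡ + dem a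
  od a = trans (upd-other h (+ r) (double≢suc i a ∘ sym)) (odd t a)

raise : ∀ {pos dem h} a m → dem a < m → Tables pos dem h → Tables pos (demand dem a m)
    (updZ h (suc (a + a)) (+ m))
raise {pos} {dem} {h} a m lt t = tables ev od
  where
  ev : ∀ k → updZ h (suc (a + a)) (+ m) (k + k) ≡ + pos k
  ev k = trans (upd-other h (+ m) (double≢suc k a)) (even t k)
  od : ∀ b → updZ h (suc (a + a)) (+ m) (suc (b + b)) ≡ + demand dem a m b
  od b with b ≟ a
  ... | yes refl = trans (upd-same h (suc (b + b)) (+ m))
        (cong +_ (sym (trans (upd-same dem b _) (m≤n⇒m⊔n≡n (<⇒≤ lt)))))
  ... | no ne    = trans (upd-other h (+ m) (ne ∘ double-injective ∘ suc-injective))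
        (trans (odd t b) (cong +_ (sym (upd-other dem _ ne))))

keep : ∀ {pos dem h} a m → m ≤ dem a → Tables pos dem h → Tables pos (demand dem a m) h
keep {pos} {dem} {h} a m le t = tables (even t) od
  where
  od : ∀ b → h (suc (b + b)) ≡ + demand dem a m b
  od b with b ≟ a
  ... | yes refl = trans (odd t b) (cong +_ (sym (trans (upd-same dem b _) (m≥n⇒m⊔n≡m le))))
  ... | no ne    = trans (odd t b) (cong +_ (sym (upd-other dem _ ne)))

branch-true : ∀ {j T U s} → positive (get s j) ≡ true → eval (branch j T U) s ≡ eval T s
branch-true e rewrite e = refl

branch-false : ∀ {j T U s} → positive (get s j) ≡ false → eval (branch j T U) s ≡ eval U s
branch-false e rewrite e = refl

fresh-pass : ∀ {T n l o t₅ k t₇ t₈ r h inp} → k ≤ n → h (k + k) ≡ + 0 →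
             ∃ λ t₇' → ∃ λ t₈' → eval (freshT T) (layout n l o t₅ (+ k) t₇ t₈ (+ r) h inp) ≡
               eval T (layout n l o t₅ (+ k) t₇' t₈' (+ r) (updZ h (k + k) (+ r)) inp)
fresh-pass {n = n} {k = k} le e rewrite sub-suc n k | positive-sub (s≤s le) | e = _ , _ , refl

fresh-high : ∀ {T n l o t₅ k t₇ t₈ r h inp} → n < k →
             eval (freshT T) (layout n l o t₅ (+ k) t₇ t₈ (+ r) h inp) ≡ halts false
fresh-high {n = n} {k = k} lt rewrite sub-suc n k | nonpositive-sub lt = refl

fresh-stale : ∀ {T n l o t₅ k t₇ t₈ r h inp p} → k ≤ n → h (k + k) ≡ + suc p →
              eval (freshT T) (layout n l o t₅ (+ k) t₇ t₈ (+ r) h inp) ≡ halts false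
fresh-stale {n = n} {k = k} le e rewrite sub-suc n k | positive-sub (s≤s le) | e = refl

free-pass : ∀ {T n l o t₅ t₆ t₇ t₈ t₉ h inp} → h (suc (l + l)) ≡ + 0 →
            ∃ λ t₇' → ∃ λ t₈' → eval (freeT T) (layout n l o t₅ t₆ t₇ t₈ t₉ h inp) ≡
              eval T (layout n l o t₅ t₆ t₇' t₈' t₉ h inp)
free-pass e rewrite e = _ , _ , refl

free-fail : ∀ {T n l o t₅ t₆ t₇ t₈ t₉ h inp d} → h (suc (l + l)) ≡ + suc d →
            eval (freeT T) (layout n l o t₅ t₆ t₇ t₈ t₉ h inp) ≡ halts false
free-fail e rewrite e = refl

raise-pass : ∀ {T n l o t₅ t₆ t₇ t₈ r h inp d} → h (suc (l + l)) ≡ + d →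
             ∃ λ t₇' → ∃ λ t₈' → eval (raiseT T) (layout n l o t₅ t₆ t₇ t₈ (+ r) h inp) ≡
               eval T (layout n l o t₅ t₆ t₇' t₈' (+ (d ⊔ r)) h inp)
raise-pass {r = r} {d = d} e rewrite e with r <? d
... | yes lt rewrite positive-sub lt | m≥n⇒m⊔n≡m (<⇒≤ lt) = _ , _ , refl
... | no nlt rewrite nonpositive-sub (≮⇒≥ nlt) | m≤n⇒m⊔n≡n (≮⇒≥ nlt) = _ , _ , refl

open Tables

encode : List Prim → List ℤ
encode = concatMap encodePrim

-- The invariant at address 15; the temporary registers are arbitrary there.
record Ready (n : ℕ) (o : Bool) (pos dem : ℕ → ℕ) (Y : List Prim) (s : Memory) : Set where
  constructor ready
  field
    {t₅ t₆ t₇ t₈ t₉} : ℤ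
    {heap}           : ℕ → ℤ
    shape            : s ≡ layout n (length Y) (bit o) t₅ t₆ t₇ t₈ t₉ heap (encode Y)
    contents         : Tables pos dem heap

store-demand : ∀ {n o pos dem Y t₅ t₆ a t₈ m h} → Tables pos dem h →
               ∃ λ s → eval storeT (layout n (length Y) (bit o) t₅ t₆ (+ a) t₈ (+ m) h
                   (encode Y)) ≡ jumps 15 s ×
                       Ready n o pos (demand dem a m) Y s
store-demand {dem = dem} {a = a} {m = m} t with dem a <? m
... | yes lt rewrite odd t a | positive-sub lt = _ , refl , ready refl (raise a m lt t)
... | no nlt rewrite odd t a | nonpositive-sub (≮⇒≥ nlt) = _ , refl , ready refl (keep a m (≮⇒≥ nlt) t)

sub-distance : ∀ {r l} → l < r → (+ r ℤ.- + suc l) ℤ.+ + 1 ≡ + (r ∸ l)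
sub-distance {r} {l} lt =
  trans (sub-suc r (suc l)) (trans (ℤₚ.m-n≡m⊖n (suc r) (suc l)) (ℤₚ.⊖-≥ (s≤s (<⇒≤ lt))))

link-pass : ∀ {n l r o t₅ t₇ t₈ t₉ h inp} → l < r →
            eval linkT (layout n r o t₅ (+ suc l) t₇ t₈ t₉ h inp) ≡
            eval storeT (layout n r o t₅ (+ suc l) (+ (r ∸ l)) t₈ t₉ h inp)
link-pass {n} {l} {r} {o} {t₅} {t₇} {t₈} {t₉} {h} {inp} lt =
  trans (cong (λ x → eval (branch 7 storeT reject) (layout n r o t₅ (+ suc l) x t₈ t₉ h inp)) (sub-distance lt))
      (far (m<n⇒0<n∸m lt))
  where
  far : ∀ {d} → 0 < d → eval (branch 7 storeT reject) (layout n r o t₅ (+ suc l) (+ d) t₈ t₉ h inp) ≡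
                        eval storeT (layout n r o t₅ (+ suc l) (+ d) t₈ t₉ h inp)
  far (s≤s _) = refl

link-fail : ∀ {n l r o t₅ t₇ t₈ t₉ h inp} → r ≤ l →
            eval linkT (layout n r o t₅ (+ suc l) t₇ t₈ t₉ h inp) ≡ halts false
link-fail {n} {l} {r} {o} {t₅} {t₇} {t₈} {t₉} {h} {inp} le =
  branch-false {7} {storeT} {reject} {layout n r o t₅ (+ suc l) ((+ r ℤ.- + suc l) ℤ.+ + 1) t₈ t₉ h inp}
    (trans (cong positive (sub-suc r (suc l))) (nonpositive-sub (s≤s le)))

-- Uniqueness of the new demands lets any derivation of `Acc` be read as one about the table that
-- the program has actually built.
SlotResult : ℕ → Bool → (pos dem : ℕ → ℕ) → ℕ → Prim → List Prim → Outcome → Set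
SlotResult n o pos dem m z Y e =
  (∃ λ dem' → SlotOk n pos dem m (length Y) z dem' × (∀ {d} → SlotOk n pos dem m (length Y) z d → d ≡ dem') ×
    ∃ λ s → e ≡ jumps 15 s × Ready n o pos dem' Y s)
  ⊎ ((∀ {d} → ¬ SlotOk n pos dem m (length Y) z d) × e ≡ halts false)

module _ {n : ℕ} {o : Bool} {pos dem : ℕ → ℕ} {m : ℕ} {Y : List Prim} {h : ℕ → ℤ} (t : Tables pos dem h) where

  state : (t₅ t₆ t₇ t₈ : ℤ) → Memory
  state t₅ t₆ t₇ t₈ = layout n (length Y) (bit o) t₅ t₆ t₇ t₈ (+ m) h (encode Y)

  via-link : ∀ z {t₅ t₇ t₈} l → (l < length Y → SlotOk n pos dem m (length Y) z (demand dem (length Y ∸ l) m)) →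
             (∀ {d} → SlotOk n pos dem m (length Y) z d → l < length Y × d ≡ demand dem (length Y ∸ l) m) →
             SlotResult n o pos dem m z Y (eval linkT (state t₅ (+ suc l) t₇ t₈))
  via-link z {t₅} {t₇} {t₈} l mk inv with l <? length Y
  ... | yes lt with store-demand {n} {o} {Y = Y} {t₅} {+ suc l} {length Y ∸ l} {t₈} {m} t
  ...   | s , e , R = inj₁
        (_ , mk lt , proj₂ ∘ inv , s , trans
            (link-pass {n} {l} {length Y} {bit o} {t₅} {t₇} {t₈} {+ m} {h} {encode Y} lt) e , R)
  via-link z {t₅} {t₇} {t₈} l mk inv | no nlt = inj₂
      ((λ ok → nlt (proj₁ (inv ok))) , link-fail {n} {l} {length Y} {bit o} {t₅} {t₇} {t₈} {+ m} {h} {encode Y}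
          (≮⇒≥ nlt))

  via-skip : ∀ {z t₅ t₇ t₈} → Skip z →
      (∀ {d} → SlotOk n pos dem m (length Y) z d → 1 < length Y × d ≡ demand dem (length Y ∸ 1) m) →
             SlotResult n o pos dem m z Y (eval linkT (state t₅ (+ 2) t₇ t₈))
  via-skip {z} {t₅} {t₇} {t₈} k inv = via-link z {t₅} {t₇} {t₈} 1 (skip k) inv

  check-pass : ∀ T {t₅} k {t₇ t₈} → (pos k ≡ 0 × k ≤ n) ⊎ m < pos k →
               ∃ λ t₇' → ∃ λ t₈' → eval (checkT T) (state t₅ (+ k) t₇ t₈) ≡ eval T (state t₅ (+ k) t₇' t₈')
  check-pass T k (inj₁ (u , le)) rewrite even t k | u | sub-suc n k | positive-sub (s≤s le) = _ , _ , refl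
  check-pass T k (inj₂ lt) rewrite even t k with pos k
  ... | suc p rewrite positive-sub lt = _ , _ , refl

  check-fail : ∀ T {t₅} k {t₇ t₈} → ¬ ((pos k ≡ 0 × k ≤ n) ⊎ m < pos k) →
               eval (checkT T) (state t₅ (+ k) t₇ t₈) ≡ halts false
  check-fail T k bad rewrite even t k with pos k
  ... | zero rewrite sub-suc n k | nonpositive-sub (≰⇒> (λ le → bad (inj₁ (refl , le)))) = refl
  ... | suc p rewrite nonpositive-sub (≮⇒≥ (bad ∘ inj₂)) = refl

  slot : ∀ z {t₅ t₆ t₇ t₈} →
         SlotResult n o pos dem m z Y
             (eval slotT (layout n (suc (length Y)) (bit o) t₅ t₆ t₇ t₈ (+ m) h (encodePrim z ++ encode Y)))
  slot (plain (outSet true))  = inj₁ (dem , set , (λ { set → refl ; (skip () _) }) , _ , refl , ready refl t)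
  slot (ptest (outSet true))  = inj₁ (dem , +set , (λ { +set → refl ; (skip () _) }) , _ , refl , ready refl t)
  slot (ntest (outSet true)) {t₆ = t₆} {t₈ = t₈} with 2 ≤? length Y
  ... | yes le = inj₁ (dem , -set le , (λ { (-set _) → refl ; (skip () _) }) , _ ,
                   branch-true {7} {loop} {reject} {state (+ 0) -[1+ 0 ] (+ length Y ℤ.- + 1) t₈}
                       (positive-sub le) , ready refl t)
  ... | no nle = inj₂ ((λ { (-set le) → nle le ; (skip () _) }) ,
                   branch-false {7} {loop} {reject} {state (+ 0) -[1+ 0 ] (+ length Y ℤ.- + 1) t₈}
                       (nonpositive-sub (≮⇒≥ nle)))
  slot (jump zero)            = inj₂ ((λ { (skip () _) }) , refl)
  slot (jump (suc l)) {t₇ = t₇} {t₈} = via-link (jump (suc l)) {+ 0} {t₇} {t₈} l link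
      (λ { (link lt) → lt , refl ; (skip () _) })
  slot (ptest (outSet false)) {t₇ = t₇} {t₈} = via-skip {t₅ = + 0} {t₇} {t₈} +out0
      (λ { (skip _ le) → le , refl })
  slot (ptest (auxGet k)) {t₇ = t₇} {t₈} = via-skip {t₅ = + 0} {t₇} {t₈} +aux (λ { (skip _ le) → le , refl })
  slot (ptest (auxSet k false)) {t₇ = t₇} {t₈} = via-skip {t₅ = + 0} {t₇} {t₈} +aux0
      (λ { (skip _ le) → le , refl })
  slot (ntest (auxSet k true)) {t₇ = t₇} {t₈} = via-skip {t₅ = + 0} {t₇} {t₈} -aux1
      (λ { (skip _ le) → le , refl })
  slot (ptest (inGet k)) {t₇ = t₇} {t₈} with (pos k ≟ 0) ×-dec (k ≤? n) ⊎-dec (m <? pos k)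
  ... | yes c with check-pass skipT {+ 0} k {t₇} {t₈} c
  ...   | t₇' , t₈' , e = subst (SlotResult n o pos dem m (ptest (inGet k)) Y) (sym e)
                            (via-link (ptest (inGet k)) {+ 0} {t₇'} {t₈'} 1 (λ lt → skipIn lt c)
                                (λ { (skip () _) ; (skipIn lt _) → lt , refl }))
  slot (ptest (inGet k)) {t₇ = t₇} {t₈} | no c = inj₂
      ((λ { (skip () _) ; (skipIn _ c') → c c' }) , check-fail skipT {+ 0} k {t₇} {t₈} c)
  slot (plain (inGet k))      = inj₂ ((λ { (skip () _) }) , refl)
  slot (plain (outSet false)) = inj₂ ((λ { (skip () _) }) , refl)
  slot (plain (auxGet k))     = inj₂ ((λ { (skip () _) }) , refl)
  slot (plain (auxSet k false)) = inj₂ ((λ { (skip () _) }) , refl)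
  slot (plain (auxSet k true))  = inj₂ ((λ { (skip () _) }) , refl)
  slot (ptest (auxSet k true))  = inj₂ ((λ { (skip () _) }) , refl)
  slot (ntest (inGet k))      = inj₂ ((λ { (skip () _) }) , refl)
  slot (ntest (outSet false)) = inj₂ ((λ { (skip () _) }) , refl)
  slot (ntest (auxGet k))     = inj₂ ((λ { (skip () _) }) , refl)
  slot (ntest (auxSet k false)) = inj₂ ((λ { (skip () _) }) , refl)
  slot halt                   = inj₂ ((λ { (skip () _) }) , refl)

open Tables

-- Correctness of one round of the main loop

code : Prim → ℕ
code (plain a)    = basicForm a
code (ptest a)    = 6 + basicForm a
code (ntest a)    = 12 + basicForm a
code (jump _)     = 18
code halt         = 19

param : Prim → ℤ
param (plain a)    = basicParam a
param (ptest a)    = basicParam a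
param (ntest a)    = basicParam a
param (jump l)     = + l
param halt         = -[1+ 0 ]

encode-code : ∀ x → encodePrim x ≡ + code x ∷ param x ∷ []
encode-code (plain a) = refl
encode-code (ptest a) = refl
encode-code (ntest a) = refl
encode-code (jump l)  = refl
encode-code halt      = refl

pick : List Tree → ℕ → Tree
pick []       c       = reject
pick (T ∷ Ts) zero    = T
pick (T ∷ Ts) (suc c) = pick Ts c

dispatch-pick : ∀ Ts c {n l o t₆ t₇ t₈ t₉ h inp} → eval (dispatch Ts) (layout n l o (+ c) t₆ t₇ t₈ t₉ h inp) ≡
                eval (pick Ts c) (layout n l o (+ 0) t₆ t₇ t₈ t₉ h inp)
dispatch-pick []       c       = refl
dispatch-pick (T ∷ Ts) zero    = refl
dispatch-pick (T ∷ Ts) (suc c) = dispatch-pick Ts c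

fetch-pick : ∀ Ts x {n l o t₅ t₆ t₇ t₈ t₉ h inp} →
             eval (READ 5 ▸ READ 6 ▸ dispatch Ts) (layout n l o t₅ t₆ t₇ t₈ t₉ h (encodePrim x ++ inp)) ≡
             eval (pick Ts (code x)) (layout n l o (+ 0) (param x) t₇ t₈ t₉ h inp)
fetch-pick Ts x {n} {l} {o} {t₅} {t₆} {t₇} {t₈} {t₉} {h} {inp} =
  trans (cong (λ w → eval (READ 5 ▸ READ 6 ▸ dispatch Ts) (layout n l o t₅ t₆ t₇ t₈ t₉ h (w ++ inp)))
      (encode-code x))
        (dispatch-pick Ts (code x))

module _ (n : ℕ) where

  -- `A` is the question posed at the start of the round; `continue` replaces it by an equivalent
  -- one about a remainder shorter than `N`, which bounds the number of rounds.
  data Result (N : ℕ) (A : Set) (T : Tree) (s : Memory) : Set where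
    verdict  : ∀ d → eval T s ≡ halts d → (d ≡ true ⇔ A) → Result N A T s
    continue : ∀ {o pos dem Y s'} → length Y < N → eval T s ≡ jumps 15 s' → Ready n o pos dem Y s' →
               (Acc n o pos dem Y ⇔ A) → Result N A T s

  step-back : ∀ {N A T s T' s'} → eval T s ≡ eval T' s' → Result N A T' s' → Result N A T s
  step-back e (verdict d e' iff)        = verdict d (trans e e') iff
  step-back e (continue lt e' R iff)    = continue lt (trans e e') R iff

  rejected : ∀ {N A T s} → ¬ A → eval T s ≡ halts false → Result N A T s
  rejected na e = verdict false e (mk⇔ (λ ()) (⊥-elim ∘ na))

  rejected-by : ∀ {N A T s} → T ≡ reject → ¬ A → Result N A T s
  rejected-by refl na = rejected na refl

  with-fetch : ∀ {N A} Ts x {l o t₅ t₆ t₇ t₈ t₉ h inp} →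
               Result N A (pick Ts (code x)) (layout n l o (+ 0) (param x) t₇ t₈ t₉ h inp) →
               Result N A (READ 5 ▸ READ 6 ▸ dispatch Ts) (layout n l o t₅ t₆ t₇ t₈ t₉ h (encodePrim x ++ inp))
  with-fetch Ts x = step-back (fetch-pick Ts x)

  with-step : ∀ {N A T l o t₅ t₆ t₇ t₈ t₉ h inp} → Result N A T (layout n l o t₅ t₆ t₇ t₈ t₉ h inp) →
              Result N A (SUB 2 2 4 ▸ T) (layout n (suc l) o t₅ t₆ t₇ t₈ t₉ h inp)
  with-step = step-back refl

  with-fresh : ∀ {pos dem h A N} T {l o t₅} i {t₇ t₈ r inp} → Tables pos dem h →
               (i ≤ n → pos i ≡ 0 → ∀ t₇ t₈ → Result N A T
                   (layout n l o t₅ (+ i) t₇ t₈ (+ r) (updZ h (i + i) (+ r)) inp)) →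
               (A → i ≤ n × pos i ≡ 0) →
               Result N A (freshT T) (layout n l o t₅ (+ i) t₇ t₈ (+ r) h inp)
  with-fresh {pos} {h = h} {A} {N} T {l} {o} {t₅} i {t₇} {t₈} {r} {inp} t k inv with i ≤? n
  ... | no nle = rejected (nle ∘ proj₁ ∘ inv)
        (fresh-high {T} {n} {l} {o} {t₅} {i} {t₇} {t₈} {r} {h} {inp} (≰⇒> nle))
  ... | yes le with pos i in eq
  ...   | zero with fresh-pass {T} {n} {l} {o} {t₅} {i} {t₇} {t₈} {r} {h} {inp} le
        (trans (even t i) (cong +_ eq))
  ...     | t₇' , t₈' , e = step-back e (k le refl t₇' t₈')
  with-fresh {pos} {h = h} {A} {N} T {l} {o} {t₅} i {t₇} {t₈} {r} {inp} t k inv | yes le | suc p =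
    rejected (λ a → case (proj₂ (inv a)))
        (fresh-stale {T} {n} {l} {o} {t₅} {i} {t₇} {t₈} {r} {h} {inp} le (trans (even t i) (cong +_ eq)))
    where
    case : suc p ≡ 0 → ⊥
    case ()

  with-free : ∀ {pos dem h A N} T {l o t₅ t₆ t₇ t₈ t₉ inp} → Tables pos dem h →
              (dem l ≡ 0 → ∀ t₇ t₈ → Result N A T (layout n l o t₅ t₆ t₇ t₈ t₉ h inp)) →
              (A → dem l ≡ 0) →
              Result N A (freeT T) (layout n l o t₅ t₆ t₇ t₈ t₉ h inp)
  with-free {dem = dem} {h} {A} {N} T {l} {o} {t₅} {t₆} {t₇} {t₈} {t₉} {inp} t k inv with dem l in eq
  ... | zero with free-pass {T} {n} {l} {o} {t₅} {t₆} {t₇} {t₈} {t₉} {h} {inp} (trans (odd t l) (cong +_ eq))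
  ...   | t₇' , t₈' , e = step-back e (k refl t₇' t₈')
  with-free {dem = dem} {h} {A} {N} T {l} {o} {t₅} {t₆} {t₇} {t₈} {t₉} {inp} t k inv | suc d =
    rejected (λ a → case (inv a))
        (free-fail {T} {n} {l} {o} {t₅} {t₆} {t₇} {t₈} {t₉} {h} {inp} (trans (odd t l) (cong +_ eq)))
    where
    case : suc d ≡ 0 → ⊥
    case ()

  with-raise : ∀ {pos dem h A N} T {l o t₅ t₆ t₇ t₈ r inp} → Tables pos dem h →
               (∀ t₇ t₈ → Result N A T (layout n l o t₅ t₆ t₇ t₈ (+ (dem l ⊔ r)) h inp)) →
               Result N A (raiseT T) (layout n l o t₅ t₆ t₇ t₈ (+ r) h inp)
  with-raise {h = h} T {l} {o} {t₅} {t₆} {t₇} {t₈} {r} {inp} t k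
    with raise-pass {T} {n} {l} {o} {t₅} {t₆} {t₇} {t₈} {r} {h} {inp} (odd t l)
  ... | t₇' , t₈' , e = step-back e (k t₇' t₈')

  from-slot : ∀ {pos dem m A N o z Y T s} → length Y < N →
              (∀ {dem'} → SlotOk n pos dem m (length Y) z dem' → Acc n o pos dem' Y → A) →
              (A → ∃ λ dem' → SlotOk n pos dem m (length Y) z dem' × Acc n o pos dem' Y) →
              SlotResult n o pos dem m z Y (eval T s) → Result N A T s
  from-slot lt mk inv (inj₂ (bad , e)) = rejected (λ a → bad (proj₁ (proj₂ (inv a)))) e
  from-slot {pos} {dem} {m} {A} {N} {o} {z} {Y} lt mk inv (inj₁ (dem' , ok , unique , s , e , R)) =
      continue lt e R (mk⇔ (mk ok) back)
    where
    back : A → Acc n o pos dem' Y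
    back a with inv a
    ... | d , ok' , acc with refl ← unique ok' = acc

  with-slot : ∀ {pos dem h A N o} z Y {t₅ t₆ t₇ t₈ r} → Tables pos dem h → length Y < N →
              (∀ {dem'} → SlotOk n pos dem (dem (suc (length Y)) ⊔ r) (length Y) z dem' → Acc n o pos dem' Y →
                  A) →
              (A → ∃ λ dem' → SlotOk n pos dem (dem (suc (length Y)) ⊔ r)
                  (length Y) z dem' × Acc n o pos dem' Y) →
              Result N A (raiseT slotT)
                  (layout n (suc (length Y)) (bit o) t₅ t₆ t₇ t₈ (+ r) h (encodePrim z ++ encode Y))
  with-slot {pos} {dem} {h} {A} {N} {o} z Y {t₅} {t₆} {r = r} t lt mk inv =
    with-raise slotT t (λ t₇ t₈ → from-slot {T = slotT} lt mk inv
        (slot {n} {o} {m = dem (suc (length Y)) ⊔ r} {Y} t z {t₅} {t₆} {t₇} {t₈}))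

  with-pair-guard : ∀ {N A T l o t₅ t₆ t₇ t₈ t₉ h inp} →
    Result N A T (layout n (3 + l) o t₅ t₆ (+ suc l) t₈ (+ (3 + l)) h inp) →
    Result N A (LOAD (+ 2) 7 ▸ SUB 7 2 7 ▸ branch 7 (ADD 9 0 2 ▸ T) reject)
        (layout n (3 + l) o t₅ t₆ t₇ t₈ t₉ h inp)
  with-pair-guard = step-back refl

  with-single-guard : ∀ {N A T l t₅ t₆ t₇ t₈ t₉ h inp} →
    Result N A T (layout n (2 + l) 1 t₅ t₆ (+ suc l) t₈ (+ (2 + l)) h inp) →
    Result N A (branch 3 (SUB 7 2 4 ▸ branch 7 (ADD 9 0 2 ▸ T) reject) reject)
        (layout n (2 + l) 1 t₅ t₆ t₇ t₈ t₉ h inp)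
  with-single-guard = step-back refl

  with-clear : ∀ {N A T l o t₅ t₆ t₇ t₈ t₉ h inp} →
    Result N A T (layout n l 0 t₅ t₆ t₇ t₈ t₉ h inp) →
    Result N A (LOAD (+ 0) 3 ▸ SUB 2 2 4 ▸ T) (layout n (suc l) o t₅ t₆ t₇ t₈ t₉ h inp)
  with-clear = step-back refl

  with-length : ∀ {N A T l o t₅ t₆ t₇ t₈ t₉ h inp} →
    Result N A T (layout n (suc l) o t₅ t₆ t₇ t₈ t₉ h inp) →
    Result N A (branch 2 T reject) (layout n (suc l) o t₅ t₆ t₇ t₈ t₉ h inp)
  with-length = step-back refl

  last-free : ∀ {N A o t₅ t₆ t₇ t₈ t₉ h inp} → h 3 ≡ + 0 → A → Result N A haltT
      (layout n 1 o t₅ t₆ t₇ t₈ t₉ h inp)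
  last-free {o = o} {t₅} {t₆} {t₇} {t₈} {t₉} {h} {inp} e a = verdict true (lem e) (mk⇔ (λ _ → a) (λ _ → refl))
    where
    lem : h 3 ≡ + 0 → eval haltT (layout n 1 o t₅ t₆ t₇ t₈ t₉ h inp) ≡ halts true
    lem e rewrite e = refl

  last-taken : ∀ {N A o t₅ t₆ t₇ t₈ t₉ h inp d} → h 3 ≡ + suc d → ¬ A → Result N A haltT
      (layout n 1 o t₅ t₆ t₇ t₈ t₉ h inp)
  last-taken {o = o} {t₅} {t₆} {t₇} {t₈} {t₉} {h} {inp} {d} e na = rejected na (lem e)
    where
    lem : h 3 ≡ + suc d → eval haltT (layout n 1 o t₅ t₆ t₇ t₈ t₉ h inp) ≡ halts false
    lem e rewrite e = refl

  second : ∀ {o pos dem h} i x z Y {t₇ t₈} → let r = 3 + length Y in Tables pos dem h →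
           Result r (Acc n o pos dem (ntest (inGet i) ∷ x ∷ z ∷ Y))
             (freshT (freeT secondT)) (layout n r (bit o) (+ 0) (+ i) t₇ t₈ (+ r) h (encode (x ∷ z ∷ Y)))
  second {o} {pos} {dem} {h} i x z Y {t₇} {t₈} t = go x
    where
    r = 3 + length Y
    Goal : Prim → Set
    Goal x = Result r (Acc n o pos dem (ntest (inGet i) ∷ x ∷ z ∷ Y))
               (freshT (freeT secondT)) (layout n r (bit o) (+ 0) (+ i) t₇ t₈ (+ r) h (encode (x ∷ z ∷ Y)))
    -- The instruction `x` is fetched only after the checks on `i`, so the rejection of a wrong `x`
    -- may already happen at one of those.
    bad : ∀ x → ¬ Acc n o pos dem (ntest (inGet i) ∷ x ∷ z ∷ Y) → pick secondCases (code x) ≡ reject → Goal x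
    bad x na e = with-fresh (freeT secondT) i t
      (λ _ _ t₇ t₈ → with-free secondT (mark i r t)
        (λ _ t₇ t₈ → with-step (with-fetch secondCases x (rejected-by e na))) (⊥-elim ∘ na)) (⊥-elim ∘ na)
    go : ∀ x → Goal x
    go (ptest (inGet j)) = with-fresh (freeT secondT) i t
      (λ i≤n pi t₇ t₈ → with-free secondT (mark i r t)
        (λ d₀ t₇ t₈ → with-step (with-fetch secondCases (ptest (inGet j))
          (with-fresh (freeT (SUB 2 2 4 ▸ raiseT slotT)) j (mark i r t)
            (λ j≤n pj t₇ t₈ → with-free (SUB 2 2 4 ▸ raiseT slotT) (mark j r (mark i r t))
              (λ d₁ t₇ t₈ → with-step (with-slot z Y (mark j r (mark i r t)) (m≤n+m _ 2)
                (λ ok acc → pair i≤n pi d₀ j≤n pj d₁ ok acc)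
                (λ { (pair _ _ _ _ _ _ ok acc) → _ , ok , acc })))
              (λ { (pair _ _ _ _ _ d₁ _ _) → d₁ }))
            (λ { (pair _ _ _ j≤n pj _ _ _) → j≤n , pj }))))
        (λ { (pair _ _ d₀ _ _ _ _ _) → d₀ }))
      (λ { (pair i≤n pi _ _ _ _ _ _) → i≤n , pi })
    go x@(plain (inGet _)) = bad x (λ ()) refl
    go x@(plain (outSet false)) = bad x (λ ()) refl
    go x@(plain (outSet true)) = bad x (λ ()) refl
    go x@(plain (auxGet _)) = bad x (λ ()) refl
    go x@(plain (auxSet _ false)) = bad x (λ ()) refl
    go x@(plain (auxSet _ true)) = bad x (λ ()) refl
    go x@(ptest (outSet false)) = bad x (λ ()) refl
    go x@(ptest (outSet true)) = bad x (λ ()) refl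
    go x@(ptest (auxGet _)) = bad x (λ ()) refl
    go x@(ptest (auxSet _ false)) = bad x (λ ()) refl
    go x@(ptest (auxSet _ true)) = bad x (λ ()) refl
    go x@(ntest (inGet _)) = bad x (λ ()) refl
    go x@(ntest (outSet false)) = bad x (λ ()) refl
    go x@(ntest (outSet true)) = bad x (λ ()) refl
    go x@(ntest (auxGet _)) = bad x (λ ()) refl
    go x@(ntest (auxSet _ false)) = bad x (λ ()) refl
    go x@(ntest (auxSet _ true)) = bad x (λ ()) refl
    go x@(jump _) = bad x (λ ()) refl
    go halt = bad halt (λ ()) refl

  body : ∀ Y {o pos dem t₅ t₆ t₇ t₈ t₉ h} → Tables pos dem h →
         Result (length Y) (Acc n o pos dem Y) bodyT (layout n (length Y) (bit o) t₅ t₆ t₇ t₈ t₉ h (encode Y))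
  body [] t = rejected (λ ()) refl
  body (x ∷ Y) {o} {pos} {dem} {t₇ = t₇} {t₈} {t₉} {h} t = with-length (with-fetch bodyCases x (go x Y t))
    where
    go : ∀ x Y → Tables pos dem h →
         Result (suc (length Y)) (Acc n o pos dem (x ∷ Y)) (pick bodyCases (code x))
           (layout n (suc (length Y)) (bit o) (+ 0) (param x) t₇ t₈ t₉ h (encode Y))
    go (ntest (inGet i)) []          t = rejected (λ ()) refl
    go (ntest (inGet i)) (x ∷ [])    t = rejected (λ ()) refl
    go (ntest (inGet i)) (x ∷ z ∷ Y) t = with-pair-guard (second i x z Y t)
    go (ptest (inGet i)) Y           t = singles o i Y t
      where
      singles : ∀ o i Y → Tables pos dem h → Result (suc (length Y))
          (Acc n o pos dem (ptest (inGet i) ∷ Y)) singleT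
                (layout n (suc (length Y)) (bit o) (+ 0) (+ i) t₇ t₈ t₉ h (encode Y))
      singles false i Y       t = rejected (λ ()) refl
      singles true  i []      t = rejected (λ ()) refl
      singles true  i (z ∷ Y) t = with-single-guard
        (with-fresh (freeT clearT) i t
          (λ i≤n pi t₇ t₈ → with-free clearT (mark i (2 + length Y) t)
            (λ d₀ t₇ t₈ → with-clear (with-slot {o = false} z Y (mark i (2 + length Y) t) (m≤n+m _ 1)
              (λ ok acc → single i≤n pi d₀ ok acc)
              (λ { (single _ _ _ ok acc) → _ , ok , acc })))
            (λ { (single _ _ d₀ _ _) → d₀ }))
          (λ { (single i≤n pi _ _ _) → i≤n , pi }))
    go halt [] t = last (dem 1) refl
      where
      last : ∀ d → dem 1 ≡ d → Result 1 (Acc n o pos dem (halt ∷ [])) haltT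
          (layout n 1 (bit o) (+ 0) -[1+ 0 ] t₇ t₈ t₉ h [])
      last zero    e = last-free (trans (odd t 1) (cong +_ e)) (stop e)
      last (suc d) e = last-taken (trans (odd t 1) (cong +_ e)) λ { (stop d₀) → 1+n≢0 (trans (sym e) d₀) }
    go halt (_ ∷ _) t = rejected (λ ()) refl
    go (plain (inGet _)) Y t = rejected (λ ()) refl
    go (plain (outSet false)) Y t = rejected (λ ()) refl
    go (plain (outSet true)) Y t = rejected (λ ()) refl
    go (plain (auxGet _)) Y t = rejected (λ ()) refl
    go (plain (auxSet _ false)) Y t = rejected (λ ()) refl
    go (plain (auxSet _ true)) Y t = rejected (λ ()) refl
    go (ptest (outSet false)) Y t = rejected (λ ()) refl
    go (ptest (outSet true)) Y t = rejected (λ ()) refl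
    go (ptest (auxGet _)) Y t = rejected (λ ()) refl
    go (ptest (auxSet _ false)) Y t = rejected (λ ()) refl
    go (ptest (auxSet _ true)) Y t = rejected (λ ()) refl
    go (ntest (outSet false)) Y t = rejected (λ ()) refl
    go (ntest (outSet true)) Y t = rejected (λ ()) refl
    go (ntest (auxGet _)) Y t = rejected (λ ()) refl
    go (ntest (auxSet _ false)) Y t = rejected (λ ()) refl
    go (ntest (auxSet _ true)) Y t = rejected (λ ()) refl
    go (jump _) Y t = rejected (λ ()) refl

-- Running time of the whole program

counted : ℕ → ℕ → Bool → (ℕ → ℤ) → List ℤ → Memory
counted n l o h inp = layout n l (bit o) (+ 0) (+ 0) (+ bit o) (+ bit o ℤ.- + 1) (+ 0) h inp

module _ (P : RProgram) (ll : Located P 4 (compile 4 lengthT)) (lb : Located P 15 (compile 15 bodyT)) where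

  -- Every return to address 15 shortens the remainder, whose length is at most `f`; the additional
  -- round is the one that gives the verdict.
  scan : ∀ {n} f Y {o pos dem s} → length Y ≤ f → Ready n o pos dem Y s →
         ∃ λ d → (∀ r → Match r s → runR P (suc f * size bodyT) (config 15 r s) ≡ just (answer d)) ×
                 (d ≡ true ⇔ Acc n o pos dem Y)
  resume : ∀ {n} f {N A s} → N ≤ f → Result n N A bodyT s →
           ∃ λ d → (∀ r → Match r s → runR P (suc f * size bodyT) (config 15 r s) ≡ just (answer d)) ×
               (d ≡ true ⇔ A)

  scan {n} f Y le (ready refl t) = resume f le (body n Y t)

  resume f {s = s} le (verdict d e iff) = d ,
      (λ r m → simulate-to P bodyT 15 {r} {s} {f * size bodyT} lb m e refl) , iff
  resume zero    le (continue lt _ _ _) = ⊥-elim (n≮0 (<-≤-trans lt le))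
  resume (suc f) {s = s} le (continue {Y = Y} lt e R iff) =
    let d , runs , iff' = scan f Y (s≤s⁻¹ (<-≤-trans lt le)) R in
    d , (λ r m → simulate-to P bodyT 15 {r} {s} {suc f * size bodyT} lb m e runs) , (iff ⇔-∘ iff')

  -- The loop keeps `L k + l` constant, with `k` in register 7 and `l` in register 2.
  count-length : ∀ {n h inp o t} k l {t₈} →
                 (∀ r → Match r (counted n (L k + l) (isOdd k) h inp) →
                   runR P t (mkConfig 15 r inp []) ≡ just o) →
                 ∀ r → Match r (layout n l 0 (+ 0) (+ 0) (+ k) t₈ (+ 0) h inp) →
                 runR P (suc k * size lengthT + t) (mkConfig 4 r inp []) ≡ just o
  count-length {n} {h} {inp} {o} {t} zero l {t₈} K r m =
    runR-mono-≤ P _ (≤-reflexive (cong (_+ t) (sym (+-identityʳ (size lengthT)))))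
        (simulate-to P lengthT 4 {r} {layout n l 0 (+ 0) (+ 0) (+ 0) t₈ (+ 0) h inp} {t} ll m refl K)
  count-length {n} {h} {inp} {o} {t} (suc zero) l {t₈} K r m =
    runR-mono-≤ P _ (+-monoˡ-≤ t (m≤m+n (size lengthT) _))
        (simulate-to P lengthT 4 {r} {layout n l 0 (+ 0) (+ 0) (+ 1) t₈ (+ 0) h inp} {t} ll m refl K)
  count-length {n} {h} {inp} {o} {t} (suc (suc k)) l {t₈} K r m =
    runR-mono-≤ P _ (≤-trans (≤-reflexive (sym (+-assoc (size lengthT) (suc k * size lengthT) t)))
        (+-monoˡ-≤ t (*-monoˡ-≤ (size lengthT) {2 + k} (n≤1+n _))))
      (simulate-to P lengthT 4 {r} {layout n l 0 (+ 0) (+ 0) (+ (2 + k)) t₈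
          (+ 0) h inp} {suc k * size lengthT + t} ll m refl
        (count-length {n} {h} {inp} {o} {t} k (3 + l) {+ 3}
            (λ r m → K r (subst (λ x → Match r (counted n x (isOdd k) h inp)) (shift k l) m))))
    where
    shift : ∀ k l → L k + (3 + l) ≡ L (2 + k) + l
    shift k l = trans (lem (L k) l) (cong (_+ l) (sym (L-suc-suc k)))
      where
      lem : ∀ x l → x + (3 + l) ≡ 3 + x + l
      lem = solve-∀

L-linear : ∀ n → 1 ≤ n → L n ≤ 3 * n
L-linear n 1≤n = *-cancelˡ-≤ 2 (begin
  2 * L n                      ≡⟨ L-tight n ⟩
  3 * n + 2 + bit (isOdd n)    ≤⟨ +-monoʳ-≤ (3 * n + 2) (bit≤1 n (isOdd n)) ⟩
  3 * n + 2 + 1                ≡⟨ +-assoc (3 * n) 2 1 ⟩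
  3 * n + 3 * 1                ≤⟨ +-monoʳ-≤ (3 * n) (*-monoʳ-≤ 3 1≤n) ⟩
  3 * n + 3 * n                ≡⟨ lem n ⟩
  2 * (3 * n)                  ∎)
  where
  open ≤-Reasoning
  lem : ∀ n → 3 * n + 3 * n ≡ 2 * (3 * n)
  lem = solve-∀

-- The left side is linear in `n`: the factors 2 and 4 come from `suc n ≤ 2 * n` and
-- `suc l ≤ 4 * n`, and one more factor `n ≥ 1` gives the square.
time-bound : ∀ a b c n l → 1 ≤ n → l ≤ 3 * n → a + (suc n * b + suc l * c) ≤ (a + (2 * b + 4 * c)) * (n * n)
time-bound a b c n l 1≤n le = begin
  a + (suc n * b + suc l * c)                ≤⟨ +-mono-≤
      (≤-trans (≤-reflexive (sym (*-identityˡ a))) (*-monoˡ-≤ a 1≤n))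
                                                  (+-mono-≤ (*-monoˡ-≤ b (+-monoˡ-≤ n 1≤n))
                                                      (*-monoˡ-≤ c (+-mono-≤ 1≤n le))) ⟩
  n * a + ((n + n) * b + (n + 3 * n) * c)    ≡⟨ lem a b c n ⟩
  (a + (2 * b + 4 * c)) * (n * 1)            ≤⟨ *-monoʳ-≤ (a + (2 * b + 4 * c)) (*-monoʳ-≤ n 1≤n) ⟩
  (a + (2 * b + 4 * c)) * (n * n)            ∎
  where
  open ≤-Reasoning
  lem : ∀ a b c n → n * a + ((n + n) * b + (n + 3 * n) * c) ≡ (a + (2 * b + 4 * c)) * (n * 1)
  lem = solve-∀

get-zeros : ∀ k i → getV (replicate k (+ 0)) (λ _ → + 0) i ≡ + 0
get-zeros zero    i       = refl
get-zeros (suc k) zero    = refl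
get-zeros (suc k) (suc i) = get-zeros k i

abstract
  decider : RProgram
  decider = compile 0 startT ++ compile 4 lengthT ++ compile 15 bodyT

  located-start : Located decider 0 (compile 0 startT)
  located-start = located-++ˡ {decider} (compile 0 startT) (compile 4 lengthT ++ compile 15 bodyT)
      (located λ _ e → e)

  located-rest : Located decider 4 (compile 4 lengthT ++ compile 15 bodyT)
  located-rest = located-++ʳ {decider} {0} (compile 0 startT) (compile 4 lengthT ++ compile 15 bodyT)
      (located λ _ e → e)

  located-length : Located decider 4 (compile 4 lengthT)
  located-length = located-++ˡ {decider} (compile 4 lengthT) (compile 15 bodyT) located-rest

  located-body : Located decider 15 (compile 15 bodyT)
  located-body = located-++ʳ {decider} {4} (compile 4 lengthT) (compile 15 bodyT) located-rest

theorem5 : Σ RProgram λ P → ∃ λ (c : ℕ) →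
    (n : ℕ) (X : List Prim) → 1 ≤ n → IS X → length X ≡ L n →
    Σ Bool λ d →
    (runR P (c * (n * n)) (initConfig (ramInput n X)) ≡ just (answer d))
    × ((d ≡ true) ⇔ Computes X (tstnz {n}))
theorem5 = decider , cost , decides
  where
  cost : ℕ
  cost = size startT + (2 * size lengthT + 4 * size bodyT)
  decides : (n : ℕ) (X : List Prim) → 1 ≤ n → IS X → length X ≡ L n → Σ Bool λ d →
    (runR decider (cost * (n * n)) (initConfig (ramInput n X)) ≡ just (answer d))
    × ((d ≡ true) ⇔ Computes X (tstnz {n}))
  decides n X 1≤n valid len = d , total ,
      (mk⇔ (Acc⇒Computes n X valid len) (Computes⇒Acc n X valid len) ⇔-∘ iff)
    where
    start : Memory
    start = memory (replicate 10 (+ 0)) (λ _ → + 0) (ramInput n X)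
    final : ℕ → Memory
    final l = counted n l (isOdd n) (λ _ → + 0) (encode X)
    decision : ∃ λ d →
      (∀ r → Match r (final (length X)) →
        runR decider (suc (length X) * size bodyT) (config 15 r (final (length X))) ≡ just (answer d)) ×
      (d ≡ true ⇔ Acc n (isOdd n) unread unread X)
    decision = scan decider located-length located-body (length X) X ≤-refl
      (ready refl (tables (λ _ → refl) (λ _ → refl)))
    d = proj₁ decision
    iff = proj₂ (proj₂ decision)
    total : runR decider (cost * (n * n)) (initConfig (ramInput n X)) ≡ just (answer d)
    total = runR-mono-≤ decider _
      (time-bound (size startT) (size lengthT) (size bodyT) n (length X) 1≤n
          (≤-trans (≤-reflexive len) (L-linear n 1≤n)))
      (simulate-to decider startT 0 {λ _ → + 0} {start} located-start (λ i → sym (get-zeros 10 i)) refl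
        (count-length decider located-length located-body n 0 λ r m →
          proj₁ (proj₂ decision) r (subst (λ l → Match r (final l)) (trans (+-identityʳ (L n)) (sym len)) m)))
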